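{- For all positive integers $n\geq 3$ and $t\geq 1$, $$ar_{bc}(K_n,t)=\begin{cases}\binom{n}{2} & \text{for } n\leq 2t,\\ t(n-1) & \text{for } 2t+1\leq n\leq 2t+3,\\ \binom{n-2}{2}+t & \text{for } n\geq 2t+4.\end{cases}$$
   Context: $K_n$ is the complete (simple) graph on $n$ vertices. A unicyclic subgraph of a graph $G$ is a spanning subgraph (on all of $V(G)$) each of whose connected components contains exactly one cycle. Given a coloring of $E(G)$, a subgraph is rainbow if its edges have pairwise distinct colors. $ar_{bc}(G,t)$ is the maximum number $m$ such that there is a coloring of $E(G)$ with exactly $m$ colors containing no $t$ pairwise edge-disjoint rainbow unicyclic subgraphs. -}

module Defs where

open import Data.Nat using (ℕ; zero; suc; _+_; _*_; _∸_; _≤_)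

open import Data.Fin using (Fin) renaming (_<_ to _<ᶠ_)
open import Data.Bool using (Bool; true)
open import Data.Product using (Σ; ∃; _×_; _,_; proj₁; proj₂)
open import Data.Sum using (_⊎_)
open import Data.List using (List; []; _∷_; _++_; [_]; zip; length)
open import Data.List.Membership.Propositional using (_∈_)
open import Data.List.Relation.Unary.All using (All)
open import Data.List.Relation.Unary.Unique.Propositional using (Unique)
open import Relation.Binary.PropositionalEquality using (_≡_; _≢_)
open import Relation.Binary.Construct.Closure.ReflexiveTransitive using (Star)
open import Relation.Nullary using (¬_)
open import Function.Bundles using (_⇔_)

-- Edges of the complete graph K_n on vertex set Fin n:
-- an edge {i,j} is represented uniquely as a pair (i , j) with i < j.
Edge : ℕ → Set
Edge n = Σ (Fin n × Fin n) (λ p → proj₁ p <ᶠ proj₂ p)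

-- A spanning subgraph of K_n is given by its edge set.
Subgraph : ℕ → Set
Subgraph n = Edge n → Bool

_∈ₛ_ : ∀ {n} → Edge n → Subgraph n → Set
e ∈ₛ S = S e ≡ true

Adj : ∀ {n} → Subgraph n → Fin n → Fin n → Set
Adj {n} S u v = ∃ λ (e : Edge n) → e ∈ₛ S ×
  ((proj₁ (proj₁ e) ≡ u × proj₂ (proj₁ e) ≡ v) ⊎ (proj₁ (proj₁ e) ≡ v × proj₂ (proj₁ e) ≡ u))

Reachable : ∀ {n} → Subgraph n → Fin n → Fin n → Set
Reachable S = Star (Adj S)

cyclicPairs : ∀ {A : Set} → List A → List (A × A)
cyclicPairs [] = []
cyclicPairs (v ∷ vs) = zip (v ∷ vs) (vs ++ [ v ])

record Cycle {n : ℕ} (S : Subgraph n) : Set where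
  field
    verts    : List (Fin n)
    long     : 3 ≤ length verts
    distinct : Unique verts
    closed   : ∀ {u v} → (u , v) ∈ cyclicPairs verts → Adj S u v

open Cycle public

CycleEdge : ∀ {n} {S : Subgraph n} → Cycle S → Fin n → Fin n → Set
CycleEdge Z u v = (u , v) ∈ cyclicPairs (verts Z) ⊎ (v , u) ∈ cyclicPairs (verts Z)

SameCycle : ∀ {n} {S : Subgraph n} → Cycle S → Cycle S → Set
SameCycle Z D = ∀ u v → CycleEdge Z u v ⇔ CycleEdge D u v

InComponentOf : ∀ {n} {S : Subgraph n} → Cycle S → Fin n → Set
InComponentOf {S = S} Z v = All (Reachable S v) (verts Z)

-- Unicyclic spanning subgraph: every connected component (the component
-- of each vertex v) contains exactly one cycle.
Unicyclic : ∀ {n} → Subgraph n → Set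
Unicyclic {n} S = ∀ (v : Fin n) →
  Σ (Cycle S) λ Z → InComponentOf Z v ×
    (∀ (D : Cycle S) → InComponentOf D v → SameCycle Z D)

Rainbow : ∀ {n m} → (Edge n → Fin m) → Subgraph n → Set
Rainbow {n} c S = ∀ (e f : Edge n) → e ∈ₛ S → f ∈ₛ S → c e ≡ c f → e ≡ f

HasDisjointRainbowUnicyclic : ∀ {n m} → (Edge n → Fin m) → ℕ → Set
HasDisjointRainbowUnicyclic {n} c t =
  Σ (Fin t → Subgraph n) λ F →
    (∀ i → Unicyclic (F i)) × (∀ i → Rainbow c (F i)) ×
    (∀ i j → i ≢ j → ∀ (e : Edge n) → e ∈ₛ F i → e ∈ₛ F j → Data.Empty.⊥)
  where import Data.Empty

-- A coloring of E(K_n) with exactly m colors: a surjection onto Fin m.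
-- Admissible n t m: some coloring with exactly m colors has no t pairwise
-- edge-disjoint rainbow unicyclic subgraphs.
Admissible : ℕ → ℕ → ℕ → Set
Admissible n t m = Σ (Edge n → Fin m) λ c →
  (∀ (k : Fin m) → ∃ λ e → c e ≡ k) × ¬ HasDisjointRainbowUnicyclic c t

IsArbc : ℕ → ℕ → ℕ → Set
IsArbc n t m = Admissible n t m × (∀ m' → Admissible n t m' → m' ≤ m)

{-# OPTIONS --safe #-}

-- A spanning subgraph is unicyclic iff its edges can be assigned bijectively to the vertices, each
-- vertex receiving an incident edge: orient every cycle cyclically and everything else towards it.
-- Hence t disjoint rainbow unicyclic subgraphs amount to giving every vertex t private incident
-- edges, labelled 1, …, t, so that equal labels have distinct colours. By König's edge-colouring
-- theorem for the bipartite multigraph of vertices and colours, labels exist as soon as no colour is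
-- used more than t times, and by Hall's theorem such an assignment exists unless some k vertices
-- meet too few edges, counted with every colour capped at t. If no colour occurs t times at
-- these k vertices, the cap is void and there are at least k(n−1)/2 ≥ tk edges. Otherwise one colour
-- contributes t, and the number of other colours met is at least m − C(n−k,2) − 1 ≥ t(k−1) when m
-- exceeds the claimed value. Conversely, few private colours together with one colour shared by all
-- remaining edges show that the claimed value is attained.
module Submission where

open import Defs
open import Data.Nat as ℕ using (ℕ; zero; suc; _+_; _*_; _∸_; _≤_; _<_; _⊓_; z≤n; s≤s; s≤s⁻¹)
open import Data.Nat.Properties as ℕₚ using (≤-refl; ≤-trans; ≤-reflexive; +-mono-≤; +-comm; +-assoc; +-suc; module ≤-Reasoning)
open import Data.Nat.Induction using (<-wellFounded)
open import Data.Nat.Combinatorics using (_C_; nC1≡n; nCk+nC[k+1]≡[n+1]C[k+1])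
open import Data.Nat.Tactic.RingSolver using (solve-∀)
open import Data.Bool using (Bool; true; false; _∧_; _∨_; not; if_then_else_) renaming (_≟_ to _≟ᵇ_)
open import Data.Fin as Fin using (Fin; zero; suc; toℕ; punchIn; punchOut; combine; join)
open import Data.Fin.Properties as Finₚ using (any?; injective⇒≤; _≟_; suc-injective; toℕ-injective)
open import Data.Fin.Subset.Properties using (anySubset?)
open import Data.Vec using (lookup; tabulate)
open import Data.Vec.Properties using (lookup∘tabulate)
open import Data.List using (List; []; _∷_; _++_; [_]; zip; length; applyUpTo)
open import Data.List.Properties using (length-applyUpTo)
open import Data.List.Membership.Propositional using (_∈_; _∉_; find; lose)
open import Data.List.Relation.Unary.Any as Any using (here; there)
open import Data.List.Relation.Unary.All as All using (All; []; _∷_)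
open import Data.List.Relation.Unary.All.Properties using () renaming (applyUpTo⁺₂ to All-applyUpTo)
open import Data.List.Relation.Unary.AllPairs using ([]; _∷_)
open import Data.List.Relation.Unary.Unique.Propositional using (Unique)
open import Data.List.Relation.Unary.Unique.Propositional.Properties using () renaming (applyUpTo⁺₁ to Unique-applyUpTo)
open import Data.Product using (Σ; ∃; ∃₂; _×_; _,_; proj₁; proj₂; uncurry)
open import Data.Sum using (_⊎_; inj₁; inj₂; swap) renaming (map to ⊎-map)
open import Data.Sum.Properties using (inj₁-injective; inj₂-injective)
open import Data.Empty using (⊥; ⊥-elim)
open import Function using (_∘_; Injective; mk⇔)
open import Induction.WellFounded using (Acc; acc)
open import Relation.Binary using (tri<; tri≈; tri>)
open import Relation.Binary.Construct.Closure.ReflexiveTransitive using (ε; _◅_; _◅◅_)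
open import Relation.Binary.PropositionalEquality using (_≡_; _≢_; refl; sym; trans; cong; cong₂; subst)
open import Relation.Nullary using (¬_; Dec; yes; no; contradiction)
open import Relation.Nullary.Decidable using (⌊_⌋; _×-dec_; ¬?)
open import Relation.Unary using (Decidable)

-- Counting and Hall's theorem

∧-elim : ∀ a {b} → a ∧ b ≡ true → a ≡ true × b ≡ true
∧-elim true p = refl , p

∧-intro : ∀ {a b} → a ≡ true → b ≡ true → a ∧ b ≡ true
∧-intro refl refl = refl

∨-elim : ∀ a {b} → a ∨ b ≡ true → a ≡ true ⊎ b ≡ true
∨-elim true  _ = inj₁ refl
∨-elim false p = inj₂ p

∨-introˡ : ∀ {a} b → a ≡ true → a ∨ b ≡ true
∨-introˡ _ refl = refl

∨-introʳ : ∀ a {b} → b ≡ true → a ∨ b ≡ true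
∨-introʳ true  _ = refl
∨-introʳ false p = p

witness : ∀ {a} {A : Set a} (A? : Dec A) → ⌊ A? ⌋ ≡ true → A
witness (yes a) _ = a

decided : ∀ {a} {A : Set a} (A? : Dec A) → A → ⌊ A? ⌋ ≡ true
decided (yes _) _ = refl
decided (no ¬a) a = contradiction a ¬a

not-true : ∀ {b} → not b ≡ true → b ≢ true
not-true {false} _ ()

not-intro : ∀ {b} → b ≢ true → not b ≡ true
not-intro {false} _ = refl
not-intro {true}  h = contradiction refl h

bit : Bool → ℕ
bit b = if b then 1 else 0

count : ∀ {n} → (Fin n → Bool) → ℕ
count {zero}  P = 0
count {suc n} P = bit (P zero) + count (P ∘ suc)

count-cong : ∀ {n} {P Q : Fin n → Bool} → (∀ i → P i ≡ Q i) → count P ≡ count Q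
count-cong {zero}  h = refl
count-cong {suc n} h = cong₂ (λ b k → bit b + k) (h zero) (count-cong (h ∘ suc))

bit-∨∧ : ∀ a b → bit (a ∨ b) + bit (a ∧ b) ≡ bit a + bit b
bit-∨∧ true  true  = refl
bit-∨∧ true  false = refl
bit-∨∧ false true  = refl
bit-∨∧ false false = refl

+-interchange : ∀ a b c d → (a + b) + (c + d) ≡ (a + c) + (b + d)
+-interchange = solve-∀

count-∨∧ : ∀ {n} (P Q : Fin n → Bool) →
  count (λ i → P i ∨ Q i) + count (λ i → P i ∧ Q i) ≡ count P + count Q
count-∨∧ {zero}  P Q = refl
count-∨∧ {suc n} P Q = trans
  (+-interchange (bit (P zero ∨ Q zero)) _ (bit (P zero ∧ Q zero)) _)
  (trans (cong₂ _+_ (bit-∨∧ (P zero) (Q zero)) (count-∨∧ (P ∘ suc) (Q ∘ suc)))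
         (+-interchange (bit (P zero)) (bit (Q zero)) _ _))

count-not : ∀ {n} (P : Fin n → Bool) → count (not ∘ P) + count P ≡ n
count-not {zero}  P = refl
count-not {suc n} P with P zero | count-not (P ∘ suc)
... | true  | h = trans (+-suc _ _) (cong suc h)
... | false | h = cong suc h

count-splitAt : ∀ a {b} (P : Fin a ⊎ Fin b → Bool) →
  count (P ∘ Fin.splitAt a) ≡ count (P ∘ inj₁) + count (P ∘ inj₂)
count-splitAt zero    P = refl
count-splitAt (suc a) P = trans
  (cong (bit (P (inj₁ zero)) +_)
    (trans (count-cong suc-case) (count-splitAt a P′)))
  (sym (+-assoc (bit (P (inj₁ zero))) _ _))
  where
  P′ : Fin a ⊎ Fin _ → Bool
  P′ (inj₁ i) = P (inj₁ (suc i))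
  P′ (inj₂ j) = P (inj₂ j)
  suc-case : ∀ i → P (Fin.splitAt (suc a) (suc i)) ≡ P′ (Fin.splitAt a i)
  suc-case i with Fin.splitAt a i
  ... | inj₁ _ = refl
  ... | inj₂ _ = refl

elements : ∀ {n} (P : Fin n → Bool) →
  Σ (Fin (count P) → Fin n) λ f → (∀ k → P (f k) ≡ true) × Injective _≡_ _≡_ f
elements {zero}  P = (λ ()) , (λ ()) , λ {}
elements {suc n} P with P zero in eq | elements (P ∘ suc)
... | true  | f , f∈ , f-inj = f′ , f′∈ , f′-inj
  where
  f′ : Fin (suc (count (P ∘ suc))) → Fin (suc n)
  f′ zero    = zero
  f′ (suc k) = suc (f k)
  f′∈ : ∀ k → P (f′ k) ≡ true
  f′∈ zero    = eq
  f′∈ (suc k) = f∈ k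
  f′-inj : Injective _≡_ _≡_ f′
  f′-inj {zero}  {zero}  _ = refl
  f′-inj {suc _} {suc _} e = cong suc (f-inj (suc-injective e))
... | false | f , f∈ , f-inj = suc ∘ f , f∈ , f-inj ∘ suc-injective

-- Strict monotonicity is kept, not only injectivity, because `Inside.relabel` must turn an edge
-- with ordered ends into an edge of a smaller complete graph whose ends are ordered again.
ranking : ∀ {n} (P : Fin n → Bool) →
  Σ (∀ i → P i ≡ true → Fin (count P)) λ r →
    ∀ {i j} p q → i Fin.< j → r i p Fin.< r j q
ranking {zero}  P = (λ ()) , λ { {()} }
ranking {suc n} P with P zero in eq | ranking (P ∘ suc)
... | true  | r , r-mono = r′ , r′-mono
  where
  r′ : ∀ i → P i ≡ true → Fin (suc (count (P ∘ suc)))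
  r′ zero    _ = zero
  r′ (suc i) p = suc (r i p)
  r′-mono : ∀ {i j} p q → i Fin.< j → r′ i p Fin.< r′ j q
  r′-mono {zero}  {suc _} _ _ _ = s≤s z≤n
  r′-mono {suc _} {suc _} p q l = s≤s (r-mono p q (s≤s⁻¹ l))
... | false | r , r-mono = r′ , r′-mono
  where
  r′ : ∀ i → P i ≡ true → Fin (count (P ∘ suc))
  r′ zero    p = contradiction (trans (sym p) eq) λ ()
  r′ (suc i) p = r i p
  r′-mono : ∀ {i j} p q → i Fin.< j → r′ i p Fin.< r′ j q
  r′-mono {zero}          p q l = contradiction (trans (sym p) eq) λ ()
  r′-mono {suc _} {suc _} p q l = r-mono p q (s≤s⁻¹ l)

rank : ∀ {n} (P : Fin n → Bool) i → P i ≡ true → Fin (count P)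
rank P = proj₁ (ranking P)

rank-mono : ∀ {n} (P : Fin n → Bool) {i j} p q → i Fin.< j → rank P i p Fin.< rank P j q
rank-mono P = proj₂ (ranking P)

rank-injective : ∀ {n} (P : Fin n → Bool) {i j} p q → rank P i p ≡ rank P j q → i ≡ j
rank-injective P {i} {j} p q e with Finₚ.<-cmp i j
... | tri≈ _ i≡j _ = i≡j
... | tri< i<j _ _ = contradiction e (Finₚ.<⇒≢ (rank-mono P p q i<j))
... | tri> _ _ i>j = contradiction (sym e) (Finₚ.<⇒≢ (rank-mono P q p i>j))

-- The basic tool for all upper bounds on counts. The map may use the membership proof, so that it
-- can be built from `rank` or defined only on `P`.
count-inj : ∀ {a b} (P : Fin a → Bool) (f : ∀ i → P i ≡ true → Fin b) →
  (∀ {i j} p q → f i p ≡ f j q → i ≡ j) → count P ≤ b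
count-inj P f f-inj =
  let g , g∈ , g-inj = elements P in
  injective⇒≤ {f = λ k → f (g k) (g∈ k)} (g-inj ∘ f-inj _ _)

count-mono : ∀ {n} {P Q : Fin n → Bool} → (∀ i → P i ≡ true → Q i ≡ true) → count P ≤ count Q
count-mono {P = P} {Q} h = count-inj P (λ i p → rank Q i (h i p)) (λ p q → rank-injective Q _ _)

count-< : ∀ {n} {P Q : Fin n → Bool} → (∀ i → P i ≡ true → Q i ≡ true) →
  ∀ {x} → P x ≢ true → Q x ≡ true → count P < count Q
count-< {P = P} {Q} P⊆Q {x} x∉P x∈Q = injective⇒≤ {f = f} f-inj
  where
  elem = proj₁ (elements P)
  elem∈ = proj₁ (proj₂ (elements P))
  elem≢x : ∀ k → elem k ≢ x
  elem≢x k e = x∉P (trans (cong P (sym e)) (elem∈ k))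
  f : Fin (suc (count P)) → Fin (count Q)
  f zero    = rank Q x x∈Q
  f (suc k) = rank Q (elem k) (P⊆Q _ (elem∈ k))
  f-inj : Injective _≡_ _≡_ f
  f-inj {zero}  {zero}  _ = refl
  f-inj {zero}  {suc l} e = contradiction (sym (rank-injective Q _ _ e)) (elem≢x l)
  f-inj {suc k} {zero}  e = contradiction (rank-injective Q _ _ e) (elem≢x k)
  f-inj {suc k} {suc l} e = cong suc (proj₂ (proj₂ (elements P)) (rank-injective Q _ _ e))

_∖_ : ∀ {n} → (Fin n → Bool) → Fin n → Fin n → Bool
(P ∖ x) i = P i ∧ not ⌊ i ≟ x ⌋

count-∖ : ∀ {n} (P : Fin n → Bool) x → count P ≤ suc (count (P ∖ x))
count-∖ {n} P x = count-inj P f f-inj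
  where
  f : ∀ i → P i ≡ true → Fin (suc (count (P ∖ x)))
  f i p with i ≟ x
  ... | yes _  = zero
  ... | no i≢x = suc (rank (P ∖ x) i (∧-intro p (not-intro (i≢x ∘ witness (i ≟ x)))))
  f-inj : ∀ {i j} p q → f i p ≡ f j q → i ≡ j
  f-inj {i} {j} p q e with i ≟ x | j ≟ x
  ... | yes refl | yes refl = refl
  ... | no _     | no _     = rank-injective (P ∖ x) _ _ (suc-injective e)

injective⇒surjective : ∀ {n} {f : Fin n → Fin n} → Injective _≡_ _≡_ f → ∀ y → ∃ λ x → f x ≡ y
injective⇒surjective {suc n} {f} f-inj y with any? (λ x → f x ≟ y)
... | yes found = found
... | no none = contradiction
  (injective⇒≤ {f = λ x → punchOut {i = y} {f x} (λ e → none (x , sym e))}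
    (f-inj ∘ Finₚ.punchOut-injective {i = y} _ _))
  ℕₚ.1+n≰n

product-injective⇒≤ : ∀ {a b k} (f : Fin a → Fin b → Fin k) →
  (∀ {x y x′ y′} → f x y ≡ f x′ y′ → x ≡ x′ × y ≡ y′) → a * b ≤ k
product-injective⇒≤ {a} {b} f f-inj = injective⇒≤ {f = h} λ {i} {j} e →
  trans (sym (Finₚ.combine-remQuot {a} b i))
    (trans (cong₂ combine (proj₁ (f-inj e)) (proj₂ (f-inj e))) (Finₚ.combine-remQuot {a} b j))
  where
  h : Fin (a * b) → Fin _
  h i = f (proj₁ (Fin.remQuot {a} b i)) (proj₂ (Fin.remQuot {a} b i))

join-injective : ∀ {a b} {x y : Fin a ⊎ Fin b} → join a b x ≡ join a b y → x ≡ y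
join-injective {a} {b} {x} {y} e =
  trans (sym (Finₚ.splitAt-join a b x)) (trans (cong (Fin.splitAt a) e) (Finₚ.splitAt-join a b y))

-- Neighbourhoods and Hall's theorem

nbr : ∀ {a b} → (Fin a → Fin b → Bool) → (Fin a → Bool) → Fin b → Bool
nbr R P y = ⌊ any? (λ x → (P x ∧ R x y) ≟ᵇ true) ⌋

nbr-intro : ∀ {a b} {R : Fin a → Fin b → Bool} {P : Fin a → Bool} {x y} →
  P x ≡ true → R x y ≡ true → nbr R P y ≡ true
nbr-intro {x = x} p r = decided (any? _) (x , ∧-intro p r)

nbr-elim : ∀ {a b} (R : Fin a → Fin b → Bool) (P : Fin a → Bool) {y} →
  nbr R P y ≡ true → ∃ λ x → P x ≡ true × R x y ≡ true
nbr-elim R P {y} h with witness (any? (λ x → (P x ∧ R x y) ≟ᵇ true)) h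
... | x , p = x , ∧-elim (P x) p

HallCondition : ∀ {a b} → (Fin a → Fin b → Bool) → Set
HallCondition R = ∀ P → count P ≤ count (nbr R P)

-- A failure must come with an explicit violating set. Subsets given as vectors can be searched
-- exhaustively, and `P` agrees pointwise with the lookup function of its table.
hallCondition? : ∀ {a b} (R : Fin a → Fin b → Bool) →
  HallCondition R ⊎ ∃ λ P → count (nbr R P) < count P
hallCondition? R with anySubset? (λ Y → count (nbr R (lookup Y)) ℕ.<? count (lookup Y))
... | yes (Y , bad) = inj₂ (lookup Y , bad)
... | no good = inj₁ λ P → begin
  count P                              ≡⟨ count-cong (λ i → lookup∘tabulate P i) ⟨
  count (lookup (tabulate P))          ≤⟨ ℕₚ.≮⇒≥ (λ bad → good (tabulate P , bad)) ⟩
  count (nbr R (lookup (tabulate P)))  ≤⟨ count-mono (transfer P) ⟩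
  count (nbr R P)                      ∎
  where
  open ≤-Reasoning
  transfer : ∀ P y → nbr R (lookup (tabulate P)) y ≡ true → nbr R P y ≡ true
  transfer P y h with nbr-elim R (lookup (tabulate P)) h
  ... | x , p , r = nbr-intro {R = R} {P} (trans (sym (lookup∘tabulate P x)) p) r

_without_ : ∀ {a b} → (Fin a → Fin b → Bool) → Fin a × Fin b → Fin a → Fin b → Bool
(R without (x , y)) x′ y′ = R x′ y′ ∧ not (⌊ x′ ≟ x ⌋ ∧ ⌊ y′ ≟ y ⌋)

without-intro : ∀ {a b} (R : Fin a → Fin b → Bool) {x y x′ y′} →
  R x′ y′ ≡ true → ¬ (x′ ≡ x × y′ ≡ y) → (R without (x , y)) x′ y′ ≡ true
without-intro R {x} {y} {x′} {y′} r h = ∧-intro r (not-intro λ e →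
  let p , q = ∧-elim ⌊ x′ ≟ x ⌋ e in h (witness (x′ ≟ x) p , witness (y′ ≟ y) q))

-- If both deletions failed, uncrossing the two violating sets by submodularity of
-- P ↦ count (nbr R P) would violate the condition for R.
delete-one : ∀ {a b} (R : Fin a → Fin b → Bool) → HallCondition R → ∀ x {y₁ y₂} → y₁ ≢ y₂ →
  HallCondition (R without (x , y₁)) ⊎ HallCondition (R without (x , y₂))
delete-one R hall x {y₁} {y₂} y₁≢y₂
  with hallCondition? (R without (x , y₁)) | hallCondition? (R without (x , y₂))
... | inj₁ good | _ = inj₁ good
... | inj₂ _    | inj₁ good = inj₂ good
... | inj₂ (P₁ , bad₁) | inj₂ (P₂ , bad₂) = contradiction both ℕₚ.1+n≰n
  where
  open ≤-Reasoning
  N₁ = nbr (R without (x , y₁)) P₁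
  N₂ = nbr (R without (x , y₂)) P₂
  P∪ = λ i → P₁ i ∨ P₂ i
  P∩ = λ i → P₁ i ∧ P₂ i
  N∪ = λ i → N₁ i ∨ N₂ i
  N∩ = λ i → N₁ i ∧ N₂ i
  R₁ = R without (x , y₁)
  R₂ = R without (x , y₂)

  -- A violating set contains `x`: otherwise the deletion does not change its neighbourhood, and the
  -- condition for `R` applies to it.
  x∈ : ∀ {y P} → count (nbr (R without (x , y)) P) < count P → P x ≡ true
  x∈ {y} {P} bad with P x in eq
  ... | true  = refl
  ... | false = contradiction (≤-trans (hall P) (count-mono include)) (ℕₚ.<⇒≱ bad)
    where
    include : ∀ z → nbr R P z ≡ true → nbr (R without (x , y)) P z ≡ true
    include z h with nbr-elim R P h
    ... | w , p , r = nbr-intro {R = R without (x , y)} {P} p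
      (without-intro R r λ { (refl , _) → contradiction (trans (sym p) eq) λ () })

  -- Only edges at `x` can get lost. As `x` lies in both sets and `y₁` differs from `y₂`, each such
  -- edge survives in at least one of the two relations.
  cover-∪ : ∀ z → nbr R P∪ z ≡ true → N∪ z ≡ true
  cover-∪ z h with nbr-elim R P∪ h
  ... | w , p , r = cases (w ≟ x) (z ≟ y₁) (∨-elim (P₁ w) p)
    where
    via₁ : P₁ w ≡ true → ¬ (w ≡ x × z ≡ y₁) → N∪ z ≡ true
    via₁ p₁ ne = ∨-introˡ _ (nbr-intro {R = R₁} {P₁} p₁ (without-intro R r ne))
    via₂ : P₂ w ≡ true → ¬ (w ≡ x × z ≡ y₂) → N∪ z ≡ true
    via₂ p₂ ne = ∨-introʳ (N₁ z) (nbr-intro {R = R₂} {P₂} p₂ (without-intro R r ne))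
    cases : Dec (w ≡ x) → Dec (z ≡ y₁) → P₁ w ≡ true ⊎ P₂ w ≡ true → N∪ z ≡ true
    cases (no w≢x)   _          (inj₁ p₁) = via₁ p₁ (w≢x ∘ proj₁)
    cases (no w≢x)   _          (inj₂ p₂) = via₂ p₂ (w≢x ∘ proj₁)
    cases (yes refl) (no z≢y₁)  _         = via₁ (x∈ bad₁) (z≢y₁ ∘ proj₂)
    cases (yes refl) (yes refl) _         = via₂ (x∈ bad₂) (y₁≢y₂ ∘ proj₂)

  cover-∩ : ∀ z → nbr R (P∩ ∖ x) z ≡ true → N∩ z ≡ true
  cover-∩ z h with nbr-elim R (P∩ ∖ x) h
  ... | w , p , r with ∧-elim (P∩ w) p
  ...   | p∩ , w≠x with ∧-elim (P₁ w) p∩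
  ...     | p₁ , p₂ = ∧-intro
    (nbr-intro {R = R₁} {P₁} p₁ (without-intro R r (w≢x ∘ proj₁)))
    (nbr-intro {R = R₂} {P₂} p₂ (without-intro R r (w≢x ∘ proj₁)))
    where
    w≢x : w ≢ x
    w≢x e = not-true w≠x (decided (w ≟ x) e)

  -- Leaving `x` out of the intersection costs one, while the two strict violations gain two.
  both : suc (count P₁ + count P₂) ≤ count P₁ + count P₂
  both = begin
    suc (count P₁ + count P₂)                     ≡⟨ cong suc (count-∨∧ P₁ P₂) ⟨
    suc (count P∪ + count P∩)                     ≤⟨ s≤s (+-mono-≤ (hall P∪) (count-∖ P∩ x)) ⟩
    suc (count (nbr R P∪) + suc (count (P∩ ∖ x)))
      ≤⟨ s≤s (+-mono-≤ (count-mono cover-∪) (s≤s (≤-trans (hall (P∩ ∖ x)) (count-mono cover-∩)))) ⟩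
    suc (count N∪ + suc (count N∩))               ≡⟨ cong suc (+-suc (count N∪) (count N∩)) ⟩
    suc (suc (count N∪ + count N∩))               ≡⟨ cong (2 +_) (count-∨∧ N₁ N₂) ⟩
    suc (suc (count N₁ + count N₂))               ≡⟨ cong suc (+-suc (count N₁) (count N₂)) ⟨
    suc (count N₁) + suc (count N₂)               ≤⟨ +-mono-≤ bad₁ bad₂ ⟩
    count P₁ + count P₂                           ∎

edgeCount : ∀ {a b} → (Fin a → Fin b → Bool) → ℕ
edgeCount {a} {b} R = count {a * b} (λ k → uncurry R (Fin.remQuot b k))

edgeCount-without : ∀ {a b} (R : Fin a → Fin b → Bool) {x y} → R x y ≡ true →
  edgeCount (R without (x , y)) < edgeCount R
edgeCount-without {a} {b} R {x} {y} r =
  count-< (λ k → proj₁ ∘ ∧-elim (uncurry R (Fin.remQuot b k))) {combine x y}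
    (subst (λ p → uncurry (R without (x , y)) p ≢ true) (sym rq) removed)
    (trans (cong (uncurry R) rq) r)
  where
  rq = Finₚ.remQuot-combine {a} {b} x y
  removed : (R without (x , y)) x y ≢ true
  removed h = not-true (proj₂ (∧-elim (R x y) h)) (∧-intro (decided (x ≟ x) refl) (decided (y ≟ y) refl))

Matching : ∀ {a b} → (Fin a → Fin b → Bool) → Set
Matching {a} {b} R = Σ (Fin a → Fin b) λ f → (∀ x → R x (f x) ≡ true) × Injective _≡_ _≡_ f

-- Rado's argument: as long as some left vertex has two neighbours, one of the two edges can be
-- deleted without destroying the condition. The number of edges bounds the recursion.
hall : ∀ {a b} (R : Fin a → Fin b → Bool) → HallCondition R → Matching R
hall R h = go (edgeCount R) R h ≤-refl
  where
  ambiguous? : ∀ {a b} (R : Fin a → Fin b → Bool) →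
    Dec (∃ λ x → ∃ λ y₁ → ∃ λ y₂ → R x y₁ ≡ true × R x y₂ ≡ true × y₁ ≢ y₂)
  ambiguous? R = any? λ x → any? λ y₁ → any? λ y₂ →
    (R x y₁ ≟ᵇ true) ×-dec (R x y₂ ≟ᵇ true) ×-dec ¬? (y₁ ≟ y₂)

  weaken : ∀ {a b} (R : Fin a → Fin b → Bool) {e} → Matching (R without e) → Matching R
  weaken R (f , f∈ , f-inj) = f , (λ x → proj₁ (∧-elim (R x (f x)) (f∈ x))) , f-inj

  -- The condition for singletons gives every left vertex a neighbour, by assumption its only one,
  -- and the condition for pairs makes these neighbours distinct.
  forced : ∀ {a b} (R : Fin a → Fin b → Bool) → HallCondition R →
    ¬ (∃ λ x → ∃ λ y₁ → ∃ λ y₂ → R x y₁ ≡ true × R x y₂ ≡ true × y₁ ≢ y₂) → Matching R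
  forced {a} {b} R h unamb = proj₁ ∘ choose , proj₂ ∘ choose , f-inj
    where
    choose : ∀ x → ∃ λ y → R x y ≡ true
    choose x with any? (λ y → R x y ≟ᵇ true)
    ... | yes found = found
    ... | no none = contradiction
      (≤-trans count-single (≤-trans (h S)
        (count-inj {b = 0} (nbr R S) (λ y p → ⊥-elim (absurd y p)) λ p q → ⊥-elim (absurd _ p)))) λ ()
      where
      S : Fin a → Bool
      S i = ⌊ i ≟ x ⌋
      count-single : 1 ≤ count S
      count-single with rank S x (decided (x ≟ x) refl)
      ... | k = ≤-trans (s≤s z≤n) (Finₚ.toℕ<n k)
      absurd : ∀ y → nbr R S y ≡ true → ⊥
      absurd y p with nbr-elim R S p
      ... | w , s , r with refl ← witness (w ≟ x) s = none (y , r)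
    f-inj : Injective _≡_ _≡_ (proj₁ ∘ choose)
    f-inj {x} {x′} e with x ≟ x′
    ... | yes x≡x′ = x≡x′
    ... | no  x≢x′ = contradiction (≤-trans two (≤-trans (h _) one)) λ { (s≤s ()) }
      where
      S : Fin a → Bool
      S i = ⌊ i ≟ x ⌋ ∨ ⌊ i ≟ x′ ⌋
      S-x : S x ≡ true
      S-x = ∨-introˡ _ (decided (x ≟ x) refl)
      S-x′ : S x′ ≡ true
      S-x′ = ∨-introʳ ⌊ x′ ≟ x ⌋ (decided (x′ ≟ x′) refl)
      pick : Fin 2 → Fin (count S)
      pick zero    = rank S x S-x
      pick (suc _) = rank S x′ S-x′
      pick-inj : Injective _≡_ _≡_ pick
      pick-inj {zero}     {zero}     _ = refl
      pick-inj {suc zero} {suc zero} _ = refl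
      pick-inj {zero}     {suc _}    q = contradiction (rank-injective S _ _ q) x≢x′
      pick-inj {suc _}    {zero}     q = contradiction (sym (rank-injective S _ _ q)) x≢x′
      two : 2 ≤ count S
      two = injective⇒≤ pick-inj
      same : ∀ {y} → nbr R S y ≡ true → y ≡ proj₁ (choose x)
      same {y} p with y ≟ proj₁ (choose x)
      ... | yes q = q
      ... | no  q with nbr-elim R S p
      ...   | w , s , r with ∨-elim ⌊ w ≟ x ⌋ s
      ...     | inj₁ s₁ with refl ← witness (w ≟ x) s₁ =
        contradiction (x , _ , _ , r , proj₂ (choose x) , q) unamb
      ...     | inj₂ s₂ with refl ← witness (w ≟ x′) s₂ =
        contradiction (x′ , _ , _ , r , proj₂ (choose x′) , q ∘ λ z → trans z (sym e)) unamb
      one : count (nbr R S) ≤ 1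
      one = count-inj (nbr R S) (λ _ _ → zero) λ p q _ → trans (same p) (sym (same q))

  go : ∀ {a b} fuel (R : Fin a → Fin b → Bool) → HallCondition R → edgeCount R ≤ fuel → Matching R
  go fuel R h le with ambiguous? R
  ... | no unamb = forced R h unamb
  go zero R h le | yes (x , y₁ , y₂ , r₁ , r₂ , ne) =
    contradiction (≤-trans (edgeCount-without R r₁) le) λ ()
  go (suc fuel) R h le | yes (x , y₁ , y₂ , r₁ , r₂ , ne) with delete-one R h x ne
  ... | inj₁ h₁ = weaken R (go fuel _ h₁ (s≤s⁻¹ (≤-trans (edgeCount-without R r₁) le)))
  ... | inj₂ h₂ = weaken R (go fuel _ h₂ (s≤s⁻¹ (≤-trans (edgeCount-without R r₂) le)))

-- König's theorem

-- Expresses that every value of `κ` occurs at most `u` times: `ρ` numbers the cells with a common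
-- value.
InjectivePair : ∀ {N M t u} → (Fin N → Fin t → Fin M) → (Fin N → Fin t → Fin u) → Set
InjectivePair κ ρ = ∀ {x s x′ s′} → κ x s ≡ κ x′ s′ → ρ x s ≡ ρ x′ s′ → x ≡ x′ × s ≡ s′

-- A proper edge-colouring with `t` labels: `σ i x` is the edge with label `i` at the left vertex
-- `x`, and edges with equal labels end at different right vertices.
RainbowColumns : ∀ {N M t} → (Fin N → Fin t → Fin M) → Set
RainbowColumns {N} {M} {t} κ = Σ (Fin t → Fin N → Fin t) λ σ →
  (∀ x → Injective _≡_ _≡_ (λ i → σ i x)) ×
  (∀ i → Injective _≡_ _≡_ (λ x → κ x (σ i x)))

-- Double counting: the `suc t` cells in each row of `P` inject into pairs of a neighbour and a
-- number below `suc t`. Cancelling `suc t` leaves Hall's condition.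
regular-matching : ∀ {t N} (κ : Fin N → Fin (suc t) → Fin N) (ρ : Fin N → Fin (suc t) → Fin (suc t)) →
  InjectivePair κ ρ → Σ (Fin N → Fin (suc t)) λ s → Injective _≡_ _≡_ (λ x → κ x (s x))
regular-matching {t} {N} κ ρ κρ-inj =
  let f , f∈ , f-inj = hall R cond
      s = λ x → witness (any? (λ s → κ x s ≟ f x)) (f∈ x)
  in proj₁ ∘ s , λ {x} {y} e → f-inj (trans (sym (proj₂ (s x))) (trans e (proj₂ (s y))))
  where
  R : Fin N → Fin N → Bool
  R x y = ⌊ any? (λ s → κ x s ≟ y) ⌋
  cond : HallCondition R
  cond P = ℕₚ.*-cancelʳ-≤ (count P) (count Q) (suc t) (product-injective⇒≤ cell cell-inj)
    where
    Q = nbr R P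
    e = proj₁ (elements P)
    κ∈Q : ∀ k s → Q (κ (e k) s) ≡ true
    κ∈Q k s = nbr-intro {R = R} {P} (proj₁ (proj₂ (elements P)) k)
      (decided (any? (λ s′ → κ (e k) s′ ≟ κ (e k) s)) (s , refl))
    cell : Fin (count P) → Fin (suc t) → Fin (count Q * suc t)
    cell k s = combine (rank Q _ (κ∈Q k s)) (ρ (e k) s)
    cell-inj : ∀ {k s l s′} → cell k s ≡ cell l s′ → k ≡ l × s ≡ s′
    cell-inj {k} {s} {l} {s′} eq =
      let eκ , eρ = Finₚ.combine-injective (rank Q _ (κ∈Q k s)) (ρ (e k) s) (rank Q _ (κ∈Q l s′)) (ρ (e l) s′) eq
          e₁ , e₂ = κρ-inj (rank-injective Q (κ∈Q k s) (κ∈Q l s′) eκ) eρ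
      in proj₂ (proj₂ (elements P)) e₁ , e₂

-- The matrices κ and ρ encode a t-regular bipartite multigraph: cell (x , s) is the edge
-- from x to κ x s, and ρ numbers the edges at each right vertex.
module RemoveMatching {t N} (κ : Fin N → Fin (suc t) → Fin N) (ρ : Fin N → Fin (suc t) → Fin (suc t))
  (κρ-inj : InjectivePair κ ρ) (σ₀ : Fin N → Fin (suc t))
  (μ-inj : Injective _≡_ _≡_ (λ x → κ x (σ₀ x))) where

  μ⁻¹ : ∀ y → ∃ λ x → κ x (σ₀ x) ≡ y
  μ⁻¹ = injective⇒surjective μ-inj

  used : Fin N → Fin (suc t)
  used y = ρ (proj₁ (μ⁻¹ y)) (σ₀ (proj₁ (μ⁻¹ y)))

  κ′ : Fin N → Fin t → Fin N
  κ′ x s = κ x (punchIn (σ₀ x) s)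

  -- At every right vertex the removed edge has a number of its own, so `punchOut` can renumber the
  -- remaining edges below `t`.
  fresh : ∀ x s → used (κ′ x s) ≢ ρ x (punchIn (σ₀ x) s)
  fresh x s e with κρ-inj (proj₂ (μ⁻¹ (κ′ x s))) e
  ... | x₀≡x , e′ = Finₚ.punchInᵢ≢i (σ₀ x) s (trans (sym e′) (cong σ₀ x₀≡x))

  ρ′ : Fin N → Fin t → Fin t
  ρ′ x s = punchOut (fresh x s)

  punchOut-injective′ : ∀ {i i′ j j′ : Fin (suc t)} (p : i ≢ j) (p′ : i′ ≢ j′) → i ≡ i′ →
    punchOut p ≡ punchOut p′ → j ≡ j′
  punchOut-injective′ p p′ refl = Finₚ.punchOut-injective p p′

  κ′ρ′-inj : InjectivePair κ′ ρ′
  κ′ρ′-inj {x} {s} {x′} {s′} eκ eρ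
    with κρ-inj eκ (punchOut-injective′ (fresh x s) (fresh x′ s′) (cong used eκ) eρ)
  ... | refl , e = refl , Finₚ.punchIn-injective (σ₀ x) s s′ e

  add-column : RainbowColumns κ′ → RainbowColumns κ
  add-column (σ′ , σ′-inj , σ′-rainbow) = σ , σ-inj , σ-rainbow
    where
    σ : Fin (suc t) → Fin N → Fin (suc t)
    σ zero    x = σ₀ x
    σ (suc i) x = punchIn (σ₀ x) (σ′ i x)
    σ-inj : ∀ x → Injective _≡_ _≡_ (λ i → σ i x)
    σ-inj x {zero}  {zero}  _ = refl
    σ-inj x {zero}  {suc j} e = contradiction (sym e) (Finₚ.punchInᵢ≢i (σ₀ x) _)
    σ-inj x {suc i} {zero}  e = contradiction e (Finₚ.punchInᵢ≢i (σ₀ x) _)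
    σ-inj x {suc i} {suc j} e = cong suc (σ′-inj x (Finₚ.punchIn-injective (σ₀ x) _ _ e))
    σ-rainbow : ∀ i → Injective _≡_ _≡_ (λ x → κ x (σ i x))
    σ-rainbow zero    = μ-inj
    σ-rainbow (suc i) = σ′-rainbow i

regular-columns : ∀ {t N} (κ : Fin N → Fin t → Fin N) (ρ : Fin N → Fin t → Fin t) →
  InjectivePair κ ρ → RainbowColumns κ
regular-columns {zero}  κ ρ κρ-inj = (λ ()) , (λ _ → λ {}) , λ ()
regular-columns {suc t} κ ρ κρ-inj = add-column (regular-columns κ′ ρ′ κ′ρ′-inj)
  where
  matching = regular-matching κ ρ κρ-inj
  open RemoveMatching κ ρ κρ-inj (proj₁ matching) (proj₂ matching)

-- The graph becomes regular after adding its mirror image and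
-- joining each colour to its mirror copy once for every unit (c , j) not used by a cell.
rainbow-columns : ∀ {n m t} (κ : Fin n → Fin t → Fin m) (ρ : Fin n → Fin t → Fin t) →
  InjectivePair κ ρ → RainbowColumns κ
rainbow-columns {n} {m} {t} κ ρ κρ-inj =
  let σ , σ-inj , σ-rainbow = regular-columns κ⁺ ρ⁺ κ⁺ρ⁺-inj in
  (λ i v → σ i (v Fin.↑ˡ m)) , (λ v → σ-inj (v Fin.↑ˡ m)) ,
  λ i {v} {w} e → Finₚ.↑ˡ-injective m v w (σ-rainbow i
    (trans (κ⁺-row v _) (trans (cong (Fin._↑ʳ_ n) e) (sym (κ⁺-row w _)))))
  where
  Node = Fin n ⊎ Fin m
  hit? : ∀ c j → Dec (∃₂ λ v s → κ v s ≡ c × ρ v s ≡ j)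
  hit? c j = any? λ v → any? λ s → (κ v s ≟ c) ×-dec (ρ v s ≟ j)

  mirror : ∀ {c j} → Dec (∃₂ λ v s → κ v s ≡ c × ρ v s ≡ j) → Node × Fin t
  mirror         (yes (v , s , _)) = inj₁ v , s
  mirror {c} {j} (no _)            = inj₂ c , j

  θ : Node → Fin t → Node × Fin t
  θ (inj₁ v) s = inj₂ (κ v s) , ρ v s
  θ (inj₂ c) j = mirror (hit? c j)

  θ-inj : ∀ x s x′ s′ → θ x s ≡ θ x′ s′ → x ≡ x′ × s ≡ s′
  θ-inj (inj₁ v) s (inj₁ v′) s′ e with κρ-inj (inj₂-injective (cong proj₁ e)) (cong proj₂ e)
  ... | refl , refl = refl , refl
  θ-inj (inj₁ v) s (inj₂ c) j e with hit? c j
  θ-inj (inj₁ v) s (inj₂ c) j refl | no none = contradiction (v , s , refl , refl) none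
  θ-inj (inj₂ c) j (inj₁ v) s e with hit? c j
  θ-inj (inj₂ c) j (inj₁ v) s refl | no none = contradiction (v , s , refl , refl) none
  θ-inj (inj₂ c) j (inj₂ c′) j′ e with hit? c j | hit? c′ j′
  θ-inj (inj₂ c) j (inj₂ c′) j′ refl | yes (v , s , refl , refl) | yes (_ , _ , refl , refl) = refl , refl
  θ-inj (inj₂ c) j (inj₂ c′) j′ refl | no _ | no _ = refl , refl

  κ⁺ : Fin (n + m) → Fin t → Fin (n + m)
  κ⁺ x s = join n m (proj₁ (θ (Fin.splitAt n x) s))
  ρ⁺ : Fin (n + m) → Fin t → Fin t
  ρ⁺ x s = proj₂ (θ (Fin.splitAt n x) s)

  κ⁺ρ⁺-inj : InjectivePair κ⁺ ρ⁺
  κ⁺ρ⁺-inj {x} {s} {x′} {s′} eκ eρ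
    with θ-inj (Fin.splitAt n x) s (Fin.splitAt n x′) s′ (cong₂ _,_ (join-injective {n} {m} eκ) eρ)
  ... | e , e′ = trans (sym (Finₚ.join-splitAt n m x)) (trans (cong (join n m) e) (Finₚ.join-splitAt n m x′)) , e′

  κ⁺-row : ∀ v s → κ⁺ (v Fin.↑ˡ m) s ≡ n Fin.↑ʳ κ v s
  κ⁺-row v s rewrite Finₚ.splitAt-↑ˡ n v m = refl

-- Orientations and unicyclic subgraphs

lo hi : ∀ {n} → Edge n → Fin n
lo e = proj₁ (proj₁ e)
hi e = proj₂ (proj₁ e)

edge-≡ : ∀ {n} {e e′ : Edge n} → lo e ≡ lo e′ → hi e ≡ hi e′ → e ≡ e′
edge-≡ {e = (i , j) , p} {(_ , _) , q} refl refl = cong ((i , j) ,_) (ℕₚ.<-irrelevant p q)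

Ends : ∀ {n} → Edge n → Fin n → Fin n → Set
Ends e u v = (lo e ≡ u × hi e ≡ v) ⊎ (lo e ≡ v × hi e ≡ u)

Ends-distinct : ∀ {n} (e : Edge n) {u v} → Ends e u v → u ≢ v
Ends-distinct (_ , i<j) (inj₁ (refl , refl)) e = Finₚ.<⇒≢ i<j e
Ends-distinct (_ , i<j) (inj₂ (refl , refl)) e = Finₚ.<⇒≢ i<j (sym e)

Ends-unique : ∀ {n} {e : Edge n} {u v u′ v′} → Ends e u v → Ends e u′ v′ →
  (u ≡ u′ × v ≡ v′) ⊎ (u ≡ v′ × v ≡ u′)
Ends-unique (inj₁ (refl , refl)) (inj₁ (refl , refl)) = inj₁ (refl , refl)
Ends-unique (inj₁ (refl , refl)) (inj₂ (refl , refl)) = inj₂ (refl , refl)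
Ends-unique (inj₂ (refl , refl)) (inj₁ (refl , refl)) = inj₂ (refl , refl)
Ends-unique (inj₂ (refl , refl)) (inj₂ (refl , refl)) = inj₁ (refl , refl)

Ends-injective : ∀ {n} {e e′ : Edge n} {u v} → Ends e u v → Ends e′ u v → e ≡ e′
Ends-injective (inj₁ (refl , refl)) (inj₁ (p , q)) = edge-≡ (sym p) (sym q)
Ends-injective (inj₂ (refl , refl)) (inj₂ (p , q)) = edge-≡ (sym p) (sym q)
Ends-injective {e = (_ , i<j)} {(_ , i′<j′)} (inj₁ (refl , refl)) (inj₂ (refl , refl)) =
  contradiction i′<j′ (ℕₚ.<-asym i<j)
Ends-injective {e = (_ , i<j)} {(_ , i′<j′)} (inj₂ (refl , refl)) (inj₁ (refl , refl)) =
  contradiction i′<j′ (ℕₚ.<-asym i<j)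

Incident : ∀ {n} → Fin n → Edge n → Set
Incident v e = lo e ≡ v ⊎ hi e ≡ v

incident? : ∀ {n} (v : Fin n) e → Dec (Incident v e)
incident? v e with lo e ≟ v | hi e ≟ v
... | yes p | _     = yes (inj₁ p)
... | no _  | yes q = yes (inj₂ q)
... | no ¬p | no ¬q = no λ { (inj₁ p) → ¬p p ; (inj₂ q) → ¬q q }

other-end : ∀ {n} {v} {e : Edge n} → Incident v e → ∃ (Ends e v)
other-end {e = e} (inj₁ p) = hi e , inj₁ (p , refl)
other-end {e = e} (inj₂ q) = lo e , inj₂ (refl , q)

Ends⇒Incident : ∀ {n} {e : Edge n} {u v} → Ends e u v → Incident u e
Ends⇒Incident (inj₁ (p , _)) = inj₁ p
Ends⇒Incident (inj₂ (_ , q)) = inj₂ q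

-- Every vertex owns one incident edge, read as an arc leaving it; injectivity means that no edge is
-- owned from both ends.
Orientation : ∀ {n} → (Fin n → Edge n) → Set
Orientation g = (∀ v → Incident v (g v)) × Injective _≡_ _≡_ g

least : ∀ {Q : ℕ → Set} → Decidable Q → ∀ {k} → Q k → ∃ λ m → Q m × (∀ i → i < m → ¬ Q i)
least {Q} Q? {k} qk = go (<-wellFounded k) qk
  where
  go : ∀ {k} → Acc _<_ k → Q k → ∃ λ m → Q m × (∀ i → i < m → ¬ Q i)
  go {k} (acc rec) qk with any? {k} (λ i → Q? (toℕ i))
  ... | yes (i , qi) = go (rec (Finₚ.toℕ<n i)) qi
  ... | no none = k , qk , λ i i<k qi →
    none (Fin.fromℕ< i<k , subst Q (sym (Finₚ.toℕ-fromℕ< i<k)) qi)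

module _ {A : Set} where

  -- The path through `x ∷ xs` with last vertex `v`. Since `cyclicPairs (x ∷ xs)` is `steps x xs x`,
  -- keeping `v` apart from the head permits induction along a cycle.
  steps : A → List A → A → List (A × A)
  steps x xs v = zip (x ∷ xs) (xs ++ [ v ])

  step-from : ∀ {u} x xs v → u ∈ x ∷ xs → ∃ λ w → (u , w) ∈ steps x xs v
  step-from x []       v (here refl) = v , here refl
  step-from x (y ∷ xs) v (here refl) = y , here refl
  step-from x (y ∷ xs) v (there u∈)  = let w , p = step-from y xs v u∈ in w , there p

  step-to : ∀ {w} x xs v → w ∈ v ∷ xs → ∃ λ u → (u , w) ∈ steps x xs v
  step-to x []       v (here refl)         = x , here refl
  step-to x (y ∷ xs) v (here refl)         = let u , p = step-to y xs v (here refl) in u , there p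
  step-to x (y ∷ xs) v (there (here refl)) = x , here refl
  step-to x (y ∷ xs) v (there (there w∈))  = let u , p = step-to y xs v (there w∈) in u , there p

  step-source : ∀ {u w} x xs v → (u , w) ∈ steps x xs v → u ∈ x ∷ xs
  step-source x []       v (here refl) = here refl
  step-source x (y ∷ xs) v (here refl) = here refl
  step-source x (y ∷ xs) v (there p)   = there (step-source y xs v p)

  step-target : ∀ {u w} x xs v → (u , w) ∈ steps x xs v → w ∈ v ∷ xs
  step-target x []       v (here refl) = here refl
  step-target x (y ∷ xs) v (here refl) = there (here refl)
  step-target x (y ∷ xs) v (there p) with step-target y xs v p
  ... | here e   = here e
  ... | there w∈ = there (there w∈)

  cyclic-from : ∀ {u} (xs : List A) → u ∈ xs → ∃ λ w → (u , w) ∈ cyclicPairs xs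
  cyclic-from (x ∷ xs) = step-from x xs x

  cyclic-to : ∀ {w} (xs : List A) → w ∈ xs → ∃ λ u → (u , w) ∈ cyclicPairs xs
  cyclic-to (x ∷ xs) = step-to x xs x

  cyclic-source : ∀ {u w} (xs : List A) → (u , w) ∈ cyclicPairs xs → u ∈ xs
  cyclic-source (x ∷ xs) = step-source x xs x

  cyclic-target : ∀ {u w} (xs : List A) → (u , w) ∈ cyclicPairs xs → w ∈ xs
  cyclic-target (x ∷ xs) = step-target x xs x

  next : List A → A → A
  next []      v = v
  next (y ∷ _) v = y

  ≢-next : ∀ {x v} ys → All (x ≢_) ys → x ≢ v → x ≢ next ys v
  ≢-next []      _       x≢v = x≢v
  ≢-next (_ ∷ _) (e ∷ _) _   = e

  final : A → List A → A
  final x []       = x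
  final x (y ∷ ys) = final y ys

  final-∈ : ∀ x xs → final x xs ∈ x ∷ xs
  final-∈ x []       = here refl
  final-∈ x (y ∷ ys) = there (final-∈ y ys)

cycle-vertex : ∀ {n} {S : Subgraph n} (D : Cycle S) → ∃ (_∈ verts D)
cycle-vertex D with verts D | long D
... | x ∷ _ | _ = x , here refl

module FunctionalGraph {n} (g : Fin n → Edge n) (g-orient : Orientation g) (S : Subgraph n)
  (g∈S : ∀ v → g v ∈ₛ S) (S⊆g : ∀ e → e ∈ₛ S → ∃ λ v → g v ≡ e) where

  g-inj : Injective _≡_ _≡_ g
  g-inj = proj₂ g-orient

  f : Fin n → Fin n
  f v = proj₁ (other-end {e = g v} (proj₁ g-orient v))

  g-ends : ∀ v → Ends (g v) v (f v)
  g-ends v = proj₂ (other-end {e = g v} (proj₁ g-orient v))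

  f-irreflexive : ∀ v → v ≢ f v
  f-irreflexive v = Ends-distinct (g v) (g-ends v)

  -- Two arcs in opposite directions would be the same edge owned by two vertices.
  f-asymmetric : ∀ {u v} → f u ≡ v → f v ≢ u
  f-asymmetric {u} refl e =
    f-irreflexive u (g-inj (Ends-injective (g-ends u) (swap (subst (Ends (g (f u)) (f u)) e (g-ends (f u))))))

  adj-f : ∀ v → Adj S v (f v)
  adj-f v = g v , g∈S v , g-ends v

  adj-cases : ∀ {u v} → Adj S u v → f u ≡ v ⊎ f v ≡ u
  adj-cases (e , e∈ , ends) with S⊆g e e∈
  ... | w , refl with Ends-unique {e = g w} ends (g-ends w)
  ...   | inj₁ (refl , e′) = inj₁ (sym e′)
  ...   | inj₂ (e′ , refl) = inj₂ (sym e′)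

  Forward Backward : Fin n × Fin n → Set
  Forward  (u , v) = f u ≡ v
  Backward (u , v) = f v ≡ u

  AdjPair : Fin n × Fin n → Set
  AdjPair (u , v) = Adj S u v

  backward-step : ∀ {p x y} → f x ≡ p → p ≢ y → Adj S x y → f y ≡ x
  backward-step fx≡p p≢y a with adj-cases a
  ... | inj₁ fx≡y = contradiction (trans (sym fx≡p) fx≡y) p≢y
  ... | inj₂ fy≡x = fy≡x

  -- The single arc leaving `x` already leads back to its predecessor `p`, so the edge to the next
  -- vertex must be owned by that next vertex. This repeats along the path.
  all-backward : ∀ {p} x xs v → f x ≡ p → p ≢ next xs v → Unique (x ∷ xs) → All (_≢ v) (x ∷ xs) →
    All AdjPair (steps x xs v) → All Backward (steps x xs v)
  all-backward x []       v fx≡p p≢ _ _ (a ∷ []) = backward-step fx≡p p≢ a ∷ []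
  all-backward x (y ∷ ys) v fx≡p p≢ (x∉ ∷ uniq) (x≢v ∷ v∉) (a ∷ as) =
    fy≡x ∷ all-backward y ys v fy≡x (≢-next ys (All.tail x∉) x≢v) uniq v∉ as
    where fy≡x = backward-step fx≡p p≢ a

  backward-final : ∀ x xs v → All Backward (steps x xs v) → f v ≡ final x xs
  backward-final x []       v (e ∷ []) = e
  backward-final x (y ∷ ys) v (_ ∷ es) = backward-final y ys v es

  forward-or-final : ∀ x xs v → Unique (x ∷ xs) → All (_≢ v) (x ∷ xs) →
    All AdjPair (steps x xs v) → All Forward (steps x xs v) ⊎ f v ≡ final x xs
  forward-or-final x [] v _ _ (a ∷ []) with adj-cases a
  ... | inj₁ e = inj₁ (e ∷ [])
  ... | inj₂ e = inj₂ e
  forward-or-final x (y ∷ ys) v (x∉ ∷ uniq′) (x≢v ∷ v∉′) (a ∷ as) with adj-cases a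
  ... | inj₁ e = ⊎-map (e ∷_) (λ z → z) (forward-or-final y ys v uniq′ v∉′ as)
  ... | inj₂ e = inj₂ (backward-final y ys v (all-backward y ys v e (≢-next ys (All.tail x∉) x≢v) uniq′ v∉′ as))

  -- A forward first step followed by a backward step later would send `f x` both to the second and
  -- to the last vertex, which differ on a cycle of length at least three.
  consistent : ∀ xs → 3 ≤ length xs → Unique xs → All AdjPair (cyclicPairs xs) →
    All Forward (cyclicPairs xs) ⊎ All Backward (cyclicPairs xs)
  consistent (x ∷ y ∷ z ∷ r) _ ((x≢y ∷ x≢z ∷ x∉) ∷ uniq@(y∉ ∷ _)) (a ∷ as) with adj-cases a
  ... | inj₂ fy≡x = inj₂ (fy≡x ∷ all-backward y (z ∷ r) x fy≡x x≢z uniq x∉′ as)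
    where x∉′ = All.map (_∘ sym) (x≢y ∷ x≢z ∷ x∉)
  ... | inj₁ fx≡y with forward-or-final y (z ∷ r) x uniq (All.map (_∘ sym) (x≢y ∷ x≢z ∷ x∉)) as
  ...   | inj₁ es = inj₁ (fx≡y ∷ es)
  ...   | inj₂ fx≡final = contradiction (trans (sym fx≡y) fx≡final) (All.lookup y∉ (final-∈ z r))
  consistent (_ ∷ []) (s≤s ()) _ _
  consistent (_ ∷ _ ∷ []) (s≤s (s≤s ())) _ _

  oriented : (D : Cycle S) → All Forward (cyclicPairs (verts D)) ⊎ All Backward (cyclicPairs (verts D))
  oriented D = consistent (verts D) (long D) (distinct D) (All.tabulate (closed D))

  module _ {P : Fin n → Set} (P-closed : ∀ {v} → P v → P (f v)) where

    forward-end : ∀ {u} x xs v → All Forward (steps x xs v) → u ∈ x ∷ xs → P u → P v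
    forward-end x []       v (e ∷ []) (here refl) p = subst P e (P-closed p)
    forward-end x (y ∷ ys) v (e ∷ es) (here refl) p = forward-end y ys v es (here refl) (subst P e (P-closed p))
    forward-end x (y ∷ ys) v (_ ∷ es) (there u∈)  p = forward-end y ys v es u∈ p

    forward-all : ∀ x xs v → All Forward (steps x xs v) → P x → All P (x ∷ xs)
    forward-all x []       v _        p = p ∷ []
    forward-all x (y ∷ ys) v (e ∷ es) p = p ∷ forward-all y ys v es (subst P e (P-closed p))

    backward-all : ∀ x xs v → All Backward (steps x xs v) → P v → All P (x ∷ xs)
    backward-all x []       v (e ∷ []) p = subst P e (P-closed p) ∷ []
    backward-all x (y ∷ ys) v (e ∷ es) p with backward-all y ys v es p
    ... | q ∷ qs = subst P e (P-closed q) ∷ q ∷ qs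

    backward-start : ∀ {u} x xs v → All Backward (steps x xs v) → u ∈ x ∷ xs → P u → P x
    backward-start x xs       v _        (here refl) p = p
    backward-start x (y ∷ ys) v (e ∷ es) (there u∈)  p = subst P e (P-closed (backward-start y ys v es u∈ p))

    -- In either orientation, following `f` from one vertex runs around the whole cycle.
    cycle-absorbed : ∀ (D : Cycle S) {u} → u ∈ verts D → P u → All P (verts D)
    cycle-absorbed D u∈ p with verts D | oriented D
    ... | x ∷ xs | inj₁ es = forward-all x xs x es (forward-end x xs x es u∈ p)
    ... | x ∷ xs | inj₂ es = backward-all x xs x es (backward-start x xs x es u∈ p)

  cycle-closed : ∀ (D : Cycle S) {v} → v ∈ verts D → f v ∈ verts D
  cycle-closed D {v} v∈ with oriented D
  ... | inj₁ es = let w , p = cyclic-from (verts D) v∈ in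
    subst (_∈ verts D) (sym (All.lookup es p)) (cyclic-target (verts D) p)
  ... | inj₂ es = let u , p = cyclic-to (verts D) v∈ in
    subst (_∈ verts D) (sym (All.lookup es p)) (cyclic-source (verts D) p)

  -- Describes the edges of a cycle by its vertex set and `f` alone, so that two cycles with the
  -- same vertices have the same edges, whatever the start or direction of their lists.
  CycleArc : Cycle S → Fin n → Fin n → Set
  CycleArc D u v = (u ∈ verts D × f u ≡ v) ⊎ (v ∈ verts D × f v ≡ u)

  edge⇒arc : ∀ (D : Cycle S) {u v} → CycleEdge D u v → CycleArc D u v
  edge⇒arc D p with oriented D
  edge⇒arc D (inj₁ p) | inj₁ es = inj₁ (cyclic-source (verts D) p , All.lookup es p)
  edge⇒arc D (inj₂ p) | inj₁ es = inj₂ (cyclic-source (verts D) p , All.lookup es p)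
  edge⇒arc D (inj₁ p) | inj₂ es = inj₂ (cyclic-target (verts D) p , All.lookup es p)
  edge⇒arc D (inj₂ p) | inj₂ es = inj₁ (cyclic-target (verts D) p , All.lookup es p)

  arc⇒edge : ∀ (D : Cycle S) {u v} → CycleArc D u v → CycleEdge D u v
  arc⇒edge D (inj₁ (u∈ , e)) = go u∈ e
    where
    go : ∀ {u v} → u ∈ verts D → f u ≡ v → CycleEdge D u v
    go u∈ refl with oriented D
    ... | inj₁ es = let w , p = cyclic-from (verts D) u∈ in
      inj₁ (subst (λ z → (_ , z) ∈ cyclicPairs (verts D)) (sym (All.lookup es p)) p)
    ... | inj₂ es = let w , p = cyclic-to (verts D) u∈ in
      inj₂ (subst (λ z → (z , _) ∈ cyclicPairs (verts D)) (sym (All.lookup es p)) p)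
  arc⇒edge D (inj₂ (v∈ , e)) = swap (arc⇒edge D (inj₁ (v∈ , e)))

  iter : ℕ → Fin n → Fin n
  iter zero    v = v
  iter (suc i) v = f (iter i v)

  iter-+ : ∀ i j v → iter (i + j) v ≡ iter i (iter j v)
  iter-+ zero    j v = refl
  iter-+ (suc i) j v = cong f (iter-+ i j v)

  -- Forward orbits that meet take the place of undirected paths: adjacent vertices merge, and
  -- merging is transitive because two meetings can be continued to a common one.
  Merge : Fin n → Fin n → Set
  Merge u v = ∃₂ λ i j → iter i u ≡ iter j v

  merge-trans : ∀ {u v w} → Merge u v → Merge v w → Merge u w
  merge-trans {u} {v} {w} (i , j , e) (k , l , e′) = k + i , j + l ,
    trans (iter-+ k i u) (trans (cong (iter k) e) (trans (sym (iter-+ k j v))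
      (trans (cong (λ z → iter z v) (+-comm k j)) (trans (iter-+ j k v)
        (trans (cong (iter j) e′) (sym (iter-+ j l w)))))))

  reachable⇒merge : ∀ {u v} → Reachable S u v → Merge u v
  reachable⇒merge ε = 0 , 0 , refl
  reachable⇒merge (a ◅ p) = merge-trans (first (adj-cases a)) (reachable⇒merge p)
    where
    first : ∀ {u v} → f u ≡ v ⊎ f v ≡ u → Merge u v
    first (inj₁ e) = 1 , 0 , e
    first (inj₂ e) = 0 , 1 , sym e

  merge-sym : ∀ {u v} → Merge u v → Merge v u
  merge-sym (i , j , e) = j , i , sym e

  cycle-iter : ∀ (D : Cycle S) i {v} → v ∈ verts D → iter i v ∈ verts D
  cycle-iter D zero    v∈ = v∈
  cycle-iter D (suc i) v∈ = cycle-closed D (cycle-iter D i v∈)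

  -- Forward orbits starting on the two cycles meet and never leave their cycles. From the common
  -- vertex each cycle absorbs the other.
  same-cycle : ∀ {v} (Z D : Cycle S) → InComponentOf Z v → InComponentOf D v → SameCycle Z D
  same-cycle Z D Z∋v D∋v u w = mk⇔ (transfer Z D Z⊆D) (transfer D Z D⊆Z)
    where
    z∈ = proj₂ (cycle-vertex Z)
    d∈ = proj₂ (cycle-vertex D)
    meet : Merge (proj₁ (cycle-vertex Z)) (proj₁ (cycle-vertex D))
    meet = merge-trans (merge-sym (reachable⇒merge (All.lookup Z∋v z∈))) (reachable⇒merge (All.lookup D∋v d∈))
    common : ∃ λ x → x ∈ verts Z × x ∈ verts D
    common = let i , j , e = meet in
      _ , cycle-iter Z i z∈ , subst (_∈ verts D) (sym e) (cycle-iter D j d∈)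
    Z⊆D : ∀ {x} → x ∈ verts Z → x ∈ verts D
    Z⊆D = All.lookup (cycle-absorbed (cycle-closed D) Z (proj₁ (proj₂ common)) (proj₂ (proj₂ common)))
    D⊆Z : ∀ {x} → x ∈ verts D → x ∈ verts Z
    D⊆Z = All.lookup (cycle-absorbed (cycle-closed Z) D (proj₂ (proj₂ common)) (proj₁ (proj₂ common)))
    transfer : ∀ (A B : Cycle S) → (∀ {x} → x ∈ verts A → x ∈ verts B) → CycleEdge A u w → CycleEdge B u w
    transfer A B A⊆B p with edge⇒arc A p
    ... | inj₁ (x∈ , e) = arc⇒edge B (inj₁ (A⊆B x∈ , e))
    ... | inj₂ (x∈ , e) = arc⇒edge B (inj₂ (A⊆B x∈ , e))

  reach-iter : ∀ i v → Reachable S v (iter i v)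
  reach-iter zero    v = ε
  reach-iter (suc i) v = reach-iter i v ◅◅ (adj-f (iter i v) ◅ ε)

  periodic-point : ∀ v → ∃₂ λ i p → iter (suc p) (iter i v) ≡ iter i v
  periodic-point v with Finₚ.pigeonhole {n} {suc n} ≤-refl (λ i → iter (toℕ i) v)
  ... | i , j , i<j , e = toℕ i , toℕ j ∸ suc (toℕ i) ,
    trans (sym (iter-+ (suc (toℕ j ∸ suc (toℕ i))) (toℕ i) v))
      (trans (cong (λ k → iter k v) (trans (sym (+-suc _ (toℕ i))) (ℕₚ.m∸n+n≡m i<j))) (sym e))

  module _ (w : Fin n) (m : ℕ) (return : iter (suc m) w ≡ w)
    (first-return : ∀ i → i < m → ¬ iter (suc i) w ≡ w) where

    orbit : List (Fin n)
    orbit = applyUpTo (λ i → iter i w) (suc m)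

    orbit-unique : Unique orbit
    orbit-unique = Unique-applyUpTo (λ i → iter i w) (suc m) λ {a} {b} a<b b<1+m e →
      let b≤m = s≤s⁻¹ b<1+m in
      -- If the orbit is at the same vertex at times `a` and `b`, the remaining `suc m ∸ b` steps
      -- already lead back to `w` from time `a`, which is too early.
      first-return (m ∸ b + a)
        (≤-trans (ℕₚ.+-monoʳ-< (m ∸ b) a<b) (≤-reflexive (ℕₚ.m∸n+n≡m b≤m)))
        (trans (iter-+ (suc (m ∸ b)) a w) (trans (cong (iter (suc (m ∸ b))) e)
          (trans (sym (iter-+ (suc (m ∸ b)) b w))
            (trans (cong (λ k → iter (suc k) w) (ℕₚ.m∸n+n≡m b≤m)) return))))

    period-≥3 : ∀ m → iter (suc m) w ≡ w → 3 ≤ suc m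
    period-≥3 zero          e = contradiction (sym e) (f-irreflexive w)
    period-≥3 (suc zero)    e = contradiction e (f-asymmetric refl)
    period-≥3 (suc (suc m)) e = s≤s (s≤s (s≤s z≤n))

    chain-forward : ∀ k (h : ℕ → Fin n) {v} → (∀ i → f (h i) ≡ h (suc i)) → f (h k) ≡ v →
      All Forward (steps (h 0) (applyUpTo (h ∘ suc) k) v)
    chain-forward zero    h link end = end ∷ []
    chain-forward (suc k) h link end = link 0 ∷ chain-forward k (h ∘ suc) (link ∘ suc) end

    orbit-cycle : Cycle S
    orbit-cycle = record
      { verts    = orbit
      ; long     = subst (3 ≤_) (sym (length-applyUpTo (λ i → iter i w) (suc m))) (period-≥3 m return)
      ; distinct = orbit-unique
      ; closed   = λ {u} p → subst (Adj S u)
          (All.lookup (chain-forward m (λ i → iter i w) (λ _ → refl) return) p) (adj-f u)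
      }

  unicyclic : Unicyclic S
  unicyclic v with periodic-point v
  ... | i , p , e with least (λ p → iter (suc p) (iter i v) ≟ iter i v) {p} e
  ...   | m , return , first-return = Z , Z∋v , λ D D∋v → same-cycle Z D Z∋v D∋v
    where
    Z = orbit-cycle (iter i v) m return first-return
    Z∋v : InComponentOf Z v
    Z∋v = All-applyUpTo (λ k → iter k (iter i v)) (suc m) λ k → reach-iter i v ◅◅ reach-iter k (iter i v)

-- From unicyclic subgraphs to orientations

module _ {A : Set} where

  path-asymmetric : ∀ {a b : A} x xs v → Unique (x ∷ xs) → All (_≢ v) (x ∷ xs) →
    (a , b) ∈ steps x xs v → (b , a) ∉ steps x xs v
  path-asymmetric x xs v (x∉ ∷ uniq) (x≢v ∷ v∉) = go xs x∉ uniq v∉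
    where
    not-target : ∀ {w} xs → All (x ≢_) xs → (w , x) ∉ steps x xs v
    not-target xs x∉ p with step-target x xs v p
    ... | here x≡v = x≢v x≡v
    ... | there x∈ = All.lookup x∉ x∈ refl
    go : ∀ {a b} xs → All (x ≢_) xs → Unique xs → All (_≢ v) xs →
      (a , b) ∈ steps x xs v → (b , a) ∉ steps x xs v
    go []       x∉ uniq v∉ (here refl) q           = not-target [] x∉ q
    go (y ∷ ys) x∉ uniq v∉ (here refl) q           = not-target (y ∷ ys) x∉ q
    go (y ∷ ys) x∉ uniq v∉ p           (here refl) = not-target (y ∷ ys) x∉ p
    go (y ∷ ys) x∉ uniq v∉ (there p)   (there q)   = path-asymmetric y ys v uniq v∉ p q

  -- Guarantees that the vertices of a cyclically oriented cycle own different edges; a closed walk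
  -- of length two would violate this.
  cyclic-asymmetric : ∀ {a b : A} xs → 3 ≤ length xs → Unique xs →
    (a , b) ∈ cyclicPairs xs → (b , a) ∉ cyclicPairs xs
  cyclic-asymmetric (_ ∷ [])     (s≤s ())
  cyclic-asymmetric (_ ∷ _ ∷ []) (s≤s (s≤s ()))
  cyclic-asymmetric (x ∷ y ∷ z ∷ r) _ ((x≢y ∷ x≢z ∷ x∉) ∷ uniq@(y∉ ∷ _)) = go
    where
    no-back : (y , x) ∉ cyclicPairs (x ∷ y ∷ z ∷ r)
    no-back (here refl)         = x≢y refl
    no-back (there (here refl)) = x≢z refl
    no-back (there (there p))   = All.lookup y∉ (step-source z r x p) refl
    go : ∀ {a b} → (a , b) ∈ cyclicPairs (x ∷ y ∷ z ∷ r) → (b , a) ∉ cyclicPairs (x ∷ y ∷ z ∷ r)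
    go (here refl) q           = no-back q
    go p@(there _) (here refl) = no-back p
    go (there p)   (there q)   =
      path-asymmetric y (z ∷ r) x uniq (All.map (_∘ sym) (x≢y ∷ x≢z ∷ x∉)) p q

-- The field `stays` keeps both ends of every owned edge in the domain. Hence an edge with an end
-- outside the domain is still free.
record PartialOrientation {n} (S : Subgraph n) : Set where
  field
    dom    : Fin n → Bool
    edge   : Fin n → Edge n
    target : Fin n → Fin n
    ends   : ∀ {v} → dom v ≡ true → Ends (edge v) v (target v)
    stays  : ∀ {v} → dom v ≡ true → dom (target v) ≡ true
    edge∈  : ∀ {v} → dom v ≡ true → edge v ∈ₛ S
    inj    : ∀ {u v} → dom u ≡ true → dom v ≡ true → edge u ≡ edge v → u ≡ v

module Extend {n} {S : Subgraph n} (o : PartialOrientation S) {A : Fin n → Set} (A? : Decidable A)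
  (fresh : ∀ {v} → A v → PartialOrientation.dom o v ≢ true)
  (arc : ∀ {v} → A v → ∃ λ w → (A w ⊎ PartialOrientation.dom o w ≡ true) × Adj S v w)
  (arc-inj : ∀ {u v} (a : A u) (b : A v) →
    proj₁ (proj₂ (proj₂ (arc a))) ≡ proj₁ (proj₂ (proj₂ (arc b))) → u ≡ v)
  where
  open PartialOrientation o

  dom′ : Fin n → Bool
  dom′ v = dom v ∨ ⌊ A? v ⌋

  edge-of : ∀ v → Dec (A v) → Edge n
  edge-of v (yes a) = proj₁ (proj₂ (proj₂ (arc a)))
  edge-of v (no _)  = edge v

  target-of : ∀ v → Dec (A v) → Fin n
  target-of v (yes a) = proj₁ (arc a)
  target-of v (no _)  = target v

  in-dom : ∀ {v} → ¬ A v → dom′ v ≡ true → dom v ≡ true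
  in-dom {v} ¬a d with ∨-elim (dom v) d
  ... | inj₁ p = p
  ... | inj₂ q = contradiction (witness (A? v) q) ¬a

  ends-of : ∀ {v} (a? : Dec (A v)) → dom′ v ≡ true → Ends (edge-of v a?) v (target-of v a?)
  ends-of (yes a) _ = proj₂ (proj₂ (proj₂ (proj₂ (arc a))))
  ends-of (no ¬a) d = ends (in-dom ¬a d)

  stays-of : ∀ {v} (a? : Dec (A v)) → dom′ v ≡ true → dom′ (target-of v a?) ≡ true
  stays-of (yes a) _ with proj₁ (proj₂ (arc a))
  ... | inj₁ a′ = ∨-introʳ (dom _) (decided (A? _) a′)
  ... | inj₂ p  = ∨-introˡ _ p
  stays-of (no ¬a) d = ∨-introˡ _ (stays (in-dom ¬a d))

  edge∈-of : ∀ {v} (a? : Dec (A v)) → dom′ v ≡ true → edge-of v a? ∈ₛ S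
  edge∈-of (yes a) _ = proj₁ (proj₂ (proj₂ (proj₂ (arc a))))
  edge∈-of (no ¬a) d = edge∈ (in-dom ¬a d)

  old≢new : ∀ {u v} (a : A u) → dom v ≡ true → proj₁ (proj₂ (proj₂ (arc a))) ≢ edge v
  old≢new {u} {v} a d e
    with Ends-unique {e = edge v}
      (subst (λ x → Ends x u (proj₁ (arc a))) e (proj₂ (proj₂ (proj₂ (proj₂ (arc a)))))) (ends d)
  ... | inj₁ (refl , _) = fresh a d
  ... | inj₂ (refl , _) = fresh a (stays d)

  inj-of : ∀ {u v} (a? : Dec (A u)) (b? : Dec (A v)) → dom′ u ≡ true → dom′ v ≡ true →
    edge-of u a? ≡ edge-of v b? → u ≡ v
  inj-of (yes a) (yes b) _ _ e = arc-inj a b e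
  inj-of (yes a) (no ¬b) _ d e = contradiction e (old≢new a (in-dom ¬b d))
  inj-of (no ¬a) (yes b) d _ e = contradiction (sym e) (old≢new b (in-dom ¬a d))
  inj-of (no ¬a) (no ¬b) d d′ e = inj (in-dom ¬a d) (in-dom ¬b d′) e

  extended : PartialOrientation S
  extended = record
    { dom    = dom′
    ; edge   = λ v → edge-of v (A? v)
    ; target = λ v → target-of v (A? v)
    ; ends   = λ {v} → ends-of (A? v)
    ; stays  = λ {v} → stays-of (A? v)
    ; edge∈  = λ {v} → edge∈-of (A? v)
    ; inj    = λ {u} {v} → inj-of (A? u) (A? v)
    }

  extended-larger : ∀ {v} → A v → count dom < count dom′
  extended-larger {v} a = count-< (λ i → ∨-introˡ _) {v} (fresh a) (∨-introʳ (dom v) (decided (A? v) a))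

crossing : ∀ {n} {S : Subgraph n} (X : Fin n → Bool) {u v} → Reachable S u v →
  X u ≢ true → X v ≡ true → ∃₂ λ a b → X a ≢ true × X b ≡ true × Adj S a b
crossing X ε u∉ v∈ = contradiction v∈ u∉
crossing X (_◅_ {j = w} a p) u∉ v∈ with X w ≟ᵇ true
... | yes w∈ = _ , _ , u∉ , w∈ , a
... | no  w∉ = crossing X p w∉ v∈

-- If the cycle in the component of `v` meets the domain, a path from `v` has an edge entering the
-- domain, and the outer end of that edge is added. Otherwise the whole cycle is added, oriented
-- cyclically.
extend : ∀ {n} {S : Subgraph n} → Unicyclic S → (o : PartialOrientation S) →
  ∀ v → PartialOrientation.dom o v ≢ true →
  ∃ λ o′ → count (PartialOrientation.dom o) < count (PartialOrientation.dom {S = S} o′)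
extend {S = S} uni o v v∉ with uni v
... | Z , Z∋v , _ with Any.any? (λ z → dom z ≟ᵇ true) (verts Z)
  where open PartialOrientation o
... | yes hit = pendant (crossing dom (All.lookup Z∋v z∈) v∉ z∈dom)
  where
  open PartialOrientation o
  z∈ = proj₁ (proj₂ (find hit))
  z∈dom = proj₂ (proj₂ (find hit))
  pendant : (∃₂ λ a b → dom a ≢ true × dom b ≡ true × Adj S a b) →
    ∃ λ o′ → count dom < count (PartialOrientation.dom {S = S} o′)
  pendant (a , b , a∉ , b∈ , adj) = extended , extended-larger refl
    where
    a-fresh : ∀ {v} → v ≡ a → dom v ≢ true
    a-fresh refl = a∉
    arc : ∀ {v} → v ≡ a → ∃ λ w → (w ≡ a ⊎ dom w ≡ true) × Adj S v w
    arc refl = b , inj₂ b∈ , adj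
    open Extend o {A = _≡ a} (_≟ a) a-fresh arc (λ u≡a v≡a _ → trans u≡a (sym v≡a))
... | no miss = extended , extended-larger (proj₂ (cycle-vertex Z))
  where
  open PartialOrientation o
  arc : ∀ {v} → v ∈ verts Z → ∃ λ w → (w ∈ verts Z ⊎ dom w ≡ true) × Adj S v w
  arc v∈ = let w , p = cyclic-from (verts Z) v∈ in w , inj₁ (cyclic-target (verts Z) p) , closed Z p
  arc-inj : ∀ {u v} (a : u ∈ verts Z) (b : v ∈ verts Z) →
    proj₁ (proj₂ (proj₂ (arc a))) ≡ proj₁ (proj₂ (proj₂ (arc b))) → u ≡ v
  arc-inj {u} {v} a b e with cyclic-from (verts Z) a | cyclic-from (verts Z) b
  ... | w , p | w′ , q with closed Z p | closed Z q
  ...   | e₁ , _ , ends₁ | e₂ , _ , ends₂ with Ends-unique {e = e₂} (subst (λ x → Ends x u w) e ends₁) ends₂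
  ...     | inj₁ (u≡v , _) = u≡v
  ...     | inj₂ (refl , refl) = contradiction q (cyclic-asymmetric (verts Z) (long Z) (distinct Z) p)
  open Extend o {A = _∈ verts Z} (λ v → Any.any? (v ≟_) (verts Z)) (λ v∈ d → miss (lose v∈ d)) arc arc-inj

unicyclic⇒orientation : ∀ {n} {S : Subgraph n} → Unicyclic S →
  ∃ λ g → Orientation g × (∀ v → g v ∈ₛ S)
unicyclic⇒orientation {n} {S} uni = go n start (ℕₚ.m≤n+m n _)
  where
  -- A default value for `edge` while the domain is still empty.
  some-edge : ∀ (Z : Cycle S) → Edge n
  some-edge Z with verts Z | long Z | closed Z
  ... | x ∷ y ∷ _ | _ | cl = proj₁ (cl (here refl))
  ... | x ∷ [] | _ | cl = proj₁ (cl (here refl))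
  start : PartialOrientation S
  start = record
    { dom = λ _ → false ; edge = λ v → some-edge (proj₁ (uni v)) ; target = λ v → v
    ; ends = λ () ; stays = λ () ; edge∈ = λ () ; inj = λ () }
  go : ∀ fuel (o : PartialOrientation S) → n ≤ count (PartialOrientation.dom o) + fuel →
    ∃ λ g → Orientation g × (∀ v → g v ∈ₛ S)
  go fuel o bound with any? (λ v → ¬? (PartialOrientation.dom o v ≟ᵇ true))
  go fuel o bound | no total =
    edge ,
    ((λ v → Ends⇒Incident {e = edge v} (ends (all v))) , λ {u} {v} → inj (all u) (all v)) ,
    λ v → edge∈ (all v)
    where
    open PartialOrientation o
    all : ∀ v → dom v ≡ true
    all v with dom v in eq
    ... | true  = refl
    ... | false = contradiction (v , λ d → contradiction (trans (sym eq) d) λ ()) total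
  go zero o bound | yes (v , v∉) = contradiction
    (≤-trans (count-< {P = PartialOrientation.dom o} {λ _ → true} (λ _ _ → refl) v∉ refl)
      (count-inj (λ _ → true) (λ i _ → i) (λ _ _ e → e)))
    (ℕₚ.≤⇒≯ (≤-trans bound (≤-reflexive (ℕₚ.+-identityʳ _))))
  go (suc fuel) o bound | yes (v , v∉) =
    let o′ , larger = extend uni o v v∉ in
    go fuel o′ (≤-trans bound (≤-trans (≤-reflexive (+-suc _ fuel)) (ℕₚ.+-monoˡ-≤ fuel larger)))

-- The colourings attaining the bound

tri : ℕ → ℕ
tri zero    = 0
tri (suc n) = n + tri n

tri≡C2 : ∀ n → tri n ≡ n C 2
tri≡C2 zero    = refl
tri≡C2 (suc n) = trans (cong₂ _+_ (sym (nC1≡n n)) (tri≡C2 n)) (nCk+nC[k+1]≡[n+1]C[k+1] n 1)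

tri-mono : ∀ {m n} → m ≤ n → tri m ≤ tri n
tri-mono z≤n       = z≤n
tri-mono (s≤s m≤n) = +-mono-≤ m≤n (tri-mono m≤n)

tri-double : ∀ n → tri n + tri n + n ≡ n * n
tri-double zero    = refl
tri-double (suc n) = trans (rearrange n (tri n)) (trans (cong (λ z → z + n + suc n) (tri-double n)) (square n))
  where
  rearrange : ∀ n x → n + x + (n + x) + suc n ≡ x + x + n + n + suc n
  rearrange = solve-∀
  square : ∀ n → n * n + n + suc n ≡ suc n * suc n
  square = solve-∀

tri-+ : ∀ j k → tri (j + k) ≡ tri j + tri k + j * k
tri-+ zero    k = sym (ℕₚ.+-identityʳ (tri k))
tri-+ (suc j) k = trans (cong (j + k +_) (tri-+ j k)) (rearrange j k (tri j) (tri k) (j * k))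
  where
  rearrange : ∀ j k x y z → j + k + (x + y + z) ≡ j + x + y + (k + z)
  rearrange = solve-∀

-- Among `n = j + k` vertices, `k` of them meet at least half their degree sum, k(n-1)/2 ≥ tk, of
-- the edges. Everything is doubled to stay within natural numbers.
tri-slope : ∀ {t} j k → 2 * t + 1 ≤ j + k → t * k + tri j ≤ tri (j + k)
tri-slope {t} j k big = ℕₚ.*-cancelˡ-≤ 2 (ℕₚ.+-cancelʳ-≤ k _ _ (begin
  2 * (t * k + tri j) + k                  ≡⟨ e₁ t k (tri j) ⟩
  (2 * t + 1) * k + 2 * tri j              ≤⟨ ℕₚ.+-monoˡ-≤ (2 * tri j) (ℕₚ.*-monoˡ-≤ k big) ⟩
  (j + k) * k + 2 * tri j                  ≤⟨ ℕₚ.m≤m+n _ (j * k) ⟩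
  (j + k) * k + 2 * tri j + j * k          ≡⟨ e₂ j k (tri j) ⟩
  k * k + 2 * (tri j + j * k)              ≡⟨ cong (_+ 2 * (tri j + j * k)) (tri-double k) ⟨
  tri k + tri k + k + 2 * (tri j + j * k)  ≡⟨ e₃ (tri j) (tri k) (j * k) k ⟩
  2 * (tri j + tri k + j * k) + k          ≡⟨ cong (λ z → 2 * z + k) (tri-+ j k) ⟨
  2 * tri (j + k) + k                      ∎))
  where
  open ≤-Reasoning
  e₁ : ∀ t k x → 2 * (t * k + x) + k ≡ (2 * t + 1) * k + 2 * x
  e₁ = solve-∀
  e₂ : ∀ j k x → (j + k) * k + 2 * x + j * k ≡ k * k + 2 * (x + j * k)
  e₂ = solve-∀
  e₃ : ∀ x y z k → y + y + k + 2 * (x + z) ≡ 2 * (x + y + z) + k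
  e₃ = solve-∀

tri-≤-linear : ∀ {t} j → j ≤ 2 * t + 1 → tri j ≤ t * j
tri-≤-linear {t} j small = ℕₚ.*-cancelˡ-≤ 2 (ℕₚ.+-cancelʳ-≤ j _ _ (begin
  2 * tri j + j       ≡⟨ e₁ (tri j) j ⟩
  tri j + tri j + j   ≡⟨ tri-double j ⟩
  j * j               ≤⟨ ℕₚ.*-monoˡ-≤ j small ⟩
  (2 * t + 1) * j     ≡⟨ e₂ t j ⟩
  2 * (t * j) + j     ∎))
  where
  open ≤-Reasoning
  e₁ : ∀ x j → 2 * x + j ≡ x + x + j
  e₁ = solve-∀
  e₂ : ∀ t j → (2 * t + 1) * j ≡ 2 * (t * j) + j
  e₂ = solve-∀

-- The colexicographic position of an edge: the edges of K_j come before all edges with upper end j.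
index : ∀ {n} → Edge n → ℕ
index e = toℕ (lo e) + tri (toℕ (hi e))

index< : ∀ {n} (e : Edge n) {k} → toℕ (hi e) < k → index e < tri k
index< e j<k = ≤-trans (ℕₚ.+-monoˡ-< (tri (toℕ (hi e))) (proj₂ e)) (tri-mono j<k)

index≥ : ∀ {n} (e : Edge n) {k} → k ≤ toℕ (hi e) → tri k ≤ index e
index≥ e k≤j = ≤-trans (tri-mono k≤j) (ℕₚ.m≤n+m _ _)

index-bounded : ∀ {n} (e : Edge n) → index e < tri n
index-bounded e = index< e (Finₚ.toℕ<n (hi e))

index-injective : ∀ {n} (e e′ : Edge n) → index e ≡ index e′ → e ≡ e′
index-injective e e′ eq with ℕₚ.<-cmp (toℕ (hi e)) (toℕ (hi e′))
... | tri< l _ _ = contradiction eq (ℕₚ.<⇒≢ (≤-trans (index< e l) (index≥ e′ ≤-refl)))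
... | tri> _ _ l = contradiction (sym eq) (ℕₚ.<⇒≢ (≤-trans (index< e′ l) (index≥ e ≤-refl)))
... | tri≈ _ h _ = edge-≡
  (toℕ-injective (ℕₚ.+-cancelʳ-≡ (tri (toℕ (hi e))) _ _ (trans eq (cong (λ z → toℕ (lo e′) + tri z) (sym h)))))
  (toℕ-injective h)

index-surjective : ∀ n {k} → k < tri n → ∃ λ (e : Edge n) → index e ≡ k
index-surjective n k< with numbers n k<
  where
  numbers : ∀ n {k} → k < tri n → ∃₂ λ i j → i < j × j < n × i + tri j ≡ k
  numbers (suc n) {k} k< with k ℕ.<? tri n
  ... | yes k<′ = let i , j , i<j , j<n , e = numbers n k<′ in i , j , i<j , ℕₚ.m≤n⇒m≤1+n j<n , e
  ... | no  k≮  = k ∸ tri n , n , ℕₚ.+-cancelʳ-< (tri n) _ _ (subst (_< n + tri n) (sym e) k<) , ≤-refl , e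
    where e = ℕₚ.m∸n+n≡m (ℕₚ.≮⇒≥ k≮)
... | i , j , i<j , j<n , e =
  ((Fin.fromℕ< (ℕₚ.<-trans i<j j<n) , Fin.fromℕ< j<n) ,
    subst (_< toℕ (Fin.fromℕ< j<n)) (sym i≡) (subst (i <_) (sym j≡) i<j)) ,
  trans (cong₂ (λ x y → x + tri y) i≡ j≡) e
  where
  i≡ = Finₚ.toℕ-fromℕ< (ℕₚ.<-trans i<j j<n)
  j≡ = Finₚ.toℕ-fromℕ< j<n

code : ∀ {n} → Edge n → Fin (tri n)
code e = Fin.fromℕ< (index-bounded e)

code-injective : ∀ {n} {e e′ : Edge n} → code e ≡ code e′ → e ≡ e′
code-injective {e = e} {e′} eq = index-injective e e′
  (Finₚ.fromℕ<-injective _ _ (index-bounded e) (index-bounded e′) eq)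

-- Edges number 0, …, M−1 get private colours and all later edges share the colour M.
module Capped (n M : ℕ) (M< : M < tri n) where

  colour : Edge n → Fin (suc M)
  colour e = Fin.fromℕ< (s≤s (ℕₚ.m⊓n≤n (index e) M))

  toℕ-colour : ∀ e → toℕ (colour e) ≡ index e ⊓ M
  toℕ-colour e = Finₚ.toℕ-fromℕ< _

  colour-surjective : ∀ k → ∃ λ e → colour e ≡ k
  colour-surjective k =
    let k≤M = s≤s⁻¹ (Finₚ.toℕ<n k)
        e , e≡ = index-surjective n (≤-trans (s≤s k≤M) M<)
    in e , toℕ-injective (trans (toℕ-colour e) (trans (cong (_⊓ M) e≡) (ℕₚ.m≤n⇒m⊓n≡m k≤M)))

  colour-shared : ∀ e e′ → M ≤ index e → M ≤ index e′ → colour e ≡ colour e′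
  colour-shared e e′ h h′ = toℕ-injective (trans (toℕ-colour e) (trans (ℕₚ.m≥n⇒m⊓n≡n h)
    (sym (trans (toℕ-colour e′) (ℕₚ.m≥n⇒m⊓n≡n h′)))))

-- Vertex `v` holds the private edges `g i v`. The last clause is edge-disjointness: a common edge
-- forces equal labels.
RainbowOrientations : ∀ {n m} → (Edge n → Fin m) → ℕ → Set
RainbowOrientations {n} c t = Σ (Fin t → Fin n → Edge n) λ g →
  (∀ i → Orientation (g i)) ×
  (∀ i {u v} → c (g i u) ≡ c (g i v) → u ≡ v) ×
  (∀ {i j u v} → g i u ≡ g j v → i ≡ j)

family⇒orientations : ∀ {n m} {c : Edge n → Fin m} {t} →
  HasDisjointRainbowUnicyclic c t → RainbowOrientations c t
family⇒orientations {n} {c = c} {t} (F , uni , rainbow , disjoint) =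
  g , g-orient , (λ i e → proj₂ (g-orient i) (rainbow i _ _ (g∈ i _) (g∈ i _) e)) , separate
  where
  g : Fin t → Fin n → Edge n
  g i = proj₁ (unicyclic⇒orientation (uni i))
  g-orient : ∀ i → Orientation (g i)
  g-orient i = proj₁ (proj₂ (unicyclic⇒orientation (uni i)))
  g∈ : ∀ i v → g i v ∈ₛ F i
  g∈ i = proj₂ (proj₂ (unicyclic⇒orientation (uni i)))
  separate : ∀ {i j u v} → g i u ≡ g j v → i ≡ j
  separate {i} {j} {u} {v} e with i ≟ j
  ... | yes i≡j = i≡j
  ... | no  i≢j = ⊥-elim (disjoint i j i≢j (g i u) (g∈ i u) (subst (_∈ₛ F j) (sym e) (g∈ j v)))

orientations-bound : ∀ {n m} {c : Edge n → Fin m} {t} → RainbowOrientations c t → t * n ≤ tri n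
orientations-bound (g , orient , _ , separate) = product-injective⇒≤ (λ i v → code (g i v)) inj
  where
  inj : ∀ {i u j v} → code (g i u) ≡ code (g j v) → i ≡ j × u ≡ v
  inj {i} e with code-injective e
  ... | e′ with refl ← separate e′ = refl , proj₂ (orient i) e′

-- Of the `t * n` owned edges at most `M` have private colours, and each of the `t` orientations has
-- at most one edge of the shared colour.
capped-bound : ∀ {n M t} (M< : M < tri n) → RainbowOrientations (Capped.colour n M M<) t → t * n ≤ M + t
capped-bound {n} {M} {t} M< (g , orient , rainbow , separate) =
  product-injective⇒≤ (λ i v → join M t (f i v (private? i v)))
    (λ {i} {u} {j} {v} e → f-inj i u j v (private? i u) (private? j v) (join-injective {M} {t} e))
  where
  open Capped n M M<
  private? : ∀ i v → Dec (index (g i v) < M)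
  private? i v = index (g i v) ℕ.<? M
  f : ∀ i v → Dec (index (g i v) < M) → Fin M ⊎ Fin t
  f i v (yes l) = inj₁ (Fin.fromℕ< l)
  f i v (no _)  = inj₂ i
  f-inj : ∀ i u j v (d : Dec (index (g i u) < M)) (d′ : Dec (index (g j v) < M)) →
    f i u d ≡ f j v d′ → i ≡ j × u ≡ v
  f-inj i u j v (yes l) (yes l′) e
    with index-injective (g i u) (g j v) (Finₚ.fromℕ<-injective _ _ l l′ (inj₁-injective e))
  ... | e′ with refl ← separate e′ = refl , proj₂ (orient i) e′
  f-inj i u j v (no h) (no h′) refl =
    refl , rainbow i (colour-shared (g i u) (g i v) (ℕₚ.≮⇒≥ h) (ℕₚ.≮⇒≥ h′))

Incident⇒≤hi : ∀ {n} {v} (e : Edge n) → Incident v e → toℕ v ≤ toℕ (hi e)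
Incident⇒≤hi e (inj₁ refl) = ℕₚ.<⇒≤ (proj₂ e)
Incident⇒≤hi e (inj₂ refl) = ≤-refl

-- Every unicyclic subgraph has two edges at the last two vertices, at most one of which has the shared colour.
no-two-vertex-cover : ∀ {n s} (M< : tri n + s < tri (2 + n)) →
  ¬ RainbowOrientations (Capped.colour (2 + n) (tri n + s) M<) (suc s)
no-two-vertex-cover {n} {s} M< (g , orient , rainbow , separate) =
  contradiction (injective⇒≤ {f = label} label-inj) ℕₚ.1+n≰n
  where
  open Capped (2 + n) (tri n + s) M<
  v₁ v₂ : Fin (2 + n)
  v₁ = Fin.fromℕ (suc n)
  v₂ = Fin.inject₁ (Fin.fromℕ n)
  toℕ-v₁ : toℕ v₁ ≡ suc n
  toℕ-v₁ = Finₚ.toℕ-fromℕ (suc n)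
  toℕ-v₂ : toℕ v₂ ≡ n
  toℕ-v₂ = trans (Finₚ.toℕ-inject₁ (Fin.fromℕ n)) (Finₚ.toℕ-fromℕ n)
  v₁≢v₂ : v₁ ≢ v₂
  v₁≢v₂ e = ℕₚ.1+n≢n (trans (sym toℕ-v₁) (trans (cong toℕ e) toℕ-v₂))
  -- In colexicographic order all edges at the last two vertices follow the `tri n` edges among the
  -- first `n`. This leaves only `s` private colours for them.
  late : ∀ i v → n ≤ toℕ v → tri n ≤ index (g i v)
  late i v n≤v = index≥ (g i v) (≤-trans n≤v (Incident⇒≤hi (g i v) (proj₁ (orient i) v)))
  private-edge : ∀ i → ∃ λ v → tri n ≤ index (g i v) × index (g i v) < tri n + s
  private-edge i with index (g i v₁) ℕ.<? tri n + s | index (g i v₂) ℕ.<? tri n + s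
  ... | yes l | _ = v₁ , late i v₁ (≤-trans (ℕₚ.n≤1+n n) (≤-reflexive (sym toℕ-v₁))) , l
  ... | no _  | yes l = v₂ , late i v₂ (≤-reflexive (sym toℕ-v₂)) , l
  ... | no h  | no h′ = contradiction
    (rainbow i (colour-shared (g i v₁) (g i v₂) (ℕₚ.≮⇒≥ h) (ℕₚ.≮⇒≥ h′))) v₁≢v₂
  offset< : ∀ i → index (g i (proj₁ (private-edge i))) ∸ tri n < s
  offset< i = let v , l , u = private-edge i in
    ℕₚ.+-cancelˡ-< (tri n) _ _ (subst (_< tri n + s) (sym (ℕₚ.m+[n∸m]≡n l)) u)
  label : Fin (suc s) → Fin s
  label i = Fin.fromℕ< (offset< i)
  label-inj : Injective _≡_ _≡_ label
  label-inj {i} {j} e = separate (index-injective _ _ (ℕₚ.∸-cancelʳ-≡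
    (proj₁ (proj₂ (private-edge i))) (proj₁ (proj₂ (private-edge j)))
    (Finₚ.fromℕ<-injective _ _ (offset< i) (offset< j) e)))

-- The upper bound

decode : ∀ n → Fin (tri n) → Edge n
decode n k = proj₁ (index-surjective n (Finₚ.toℕ<n k))

index-decode : ∀ n k → index (decode n k) ≡ toℕ k
index-decode n k = proj₂ (index-surjective n (Finₚ.toℕ<n k))

decode-code : ∀ {n} (e : Edge n) → decode n (code e) ≡ e
decode-code {n} e = index-injective _ e (trans (index-decode n (code e)) (Finₚ.toℕ-fromℕ< (index-bounded e)))

decode-injective : ∀ n {k l} → decode n k ≡ decode n l → k ≡ l
decode-injective n {k} {l} e =
  toℕ-injective (trans (sym (index-decode n k)) (trans (cong index e) (index-decode n l)))

module Inside {n} (Y : Fin n → Bool) where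

  relabel : ∀ (e : Edge n) → Y (lo e) ≡ true → Y (hi e) ≡ true → Edge (count Y)
  relabel e p q = (rank Y (lo e) p , rank Y (hi e) q) , rank-mono Y p q (proj₂ e)

  inside-code : ∀ (e : Edge n) → Y (lo e) ≡ true → Y (hi e) ≡ true → Fin (tri (count Y))
  inside-code e p q = code (relabel e p q)

  inside-code-injective : ∀ e e′ {p q p′ q′} → inside-code e p q ≡ inside-code e′ p′ q′ → e ≡ e′
  inside-code-injective e e′ {p} {q} {p′} {q′} eq =
    let eq′ = code-injective {e = relabel e p q} {relabel e′ p′ q′} eq in
    edge-≡ (rank-injective Y p p′ (cong lo eq′)) (rank-injective Y q q′ (cong hi eq′))

count-⊎ : ∀ {a b} (P : Fin (a + b) → Bool) → count P ≡ count (P ∘ (Fin._↑ˡ b)) + count (P ∘ (a Fin.↑ʳ_))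
count-⊎ {a} {b} P = trans (count-cong (λ i → cong P (sym (Finₚ.join-splitAt a b i)))) (count-splitAt a (P ∘ join a b))

-- Hall's condition for assigning edges to vertices

module Assignment {n m : ℕ} (c : Edge n → Fin m) (c-surj : ∀ k → ∃ λ e → c e ≡ k) (t : ℕ) where

  E = tri n
  -- A slot is a vertex with one of its `t` demands; a unit is a colour with one of its `t`
  -- permitted uses.
  Slots = n * t
  Units = m * t

  row : Fin Slots → Fin n
  row a = proj₁ (Fin.remQuot {n} t a)

  colour-of : Fin Units → Fin m
  colour-of d = proj₁ (Fin.remQuot {m} t d)

  -- An edge on the left can be matched to itself only if no vertex uses it; a used edge therefore
  -- occupies one of the t units of its colour.
  related : Fin Slots ⊎ Fin E → Fin E ⊎ Fin Units → Bool
  related (inj₁ a) (inj₁ b)  = ⌊ incident? (row a) (decode n b) ⌋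
  related (inj₁ a) (inj₂ d)  = false
  related (inj₂ b) (inj₁ b′) = ⌊ b ≟ b′ ⌋
  related (inj₂ b) (inj₂ d)  = ⌊ c (decode n b) ≟ colour-of d ⌋

  R : Fin (Slots + E) → Fin (E + Units) → Bool
  R x y = related (Fin.splitAt Slots x) (Fin.splitAt E y)

  R-join : ∀ x y → related x y ≡ true → R (join Slots E x) (join E Units y) ≡ true
  R-join x y r rewrite Finₚ.splitAt-join Slots E x | Finₚ.splitAt-join E Units y = r

  -- The left set `P` consists of slots, whose vertices form `X`, and of edges `F` with colours `K`.
  -- Its neighbourhood contains the edges of `F`, the other edges `D` meeting `X`, and all `t` units
  -- of each colour in `K`.
  module Deficiency (P : Fin (Slots + E) → Bool) where

    slots : Fin Slots → Bool
    slots a = P (a Fin.↑ˡ E)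

    F : Fin E → Bool
    F b = P (Slots Fin.↑ʳ b)

    X : Fin n → Bool
    X v = ⌊ any? (λ s → slots (combine v s) ≟ᵇ true) ⌋

    X-intro : ∀ {a} → slots a ≡ true → X (row a) ≡ true
    X-intro {a} p = decided (any? (λ s → slots (combine (row a) s) ≟ᵇ true))
      (proj₂ (Fin.remQuot {n} t a) , trans (cong slots (Finₚ.combine-remQuot {n} t a)) p)

    X-elim : ∀ {v} → X v ≡ true → ∃ λ a → slots a ≡ true × row a ≡ v
    X-elim {v} p = let s , q = witness (any? (λ s → slots (combine v s) ≟ᵇ true)) p in
      combine v s , q , cong proj₁ (Finₚ.remQuot-combine {n} {t} v s)

    Y : Fin n → Bool
    Y = not ∘ X

    touches : Edge n → Bool
    touches e = X (lo e) ∨ X (hi e)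

    D : Fin E → Bool
    D b = touches (decode n b) ∧ not (F b)

    K : Fin m → Bool
    K k = ⌊ any? (λ b → (F b ≟ᵇ true) ×-dec (c (decode n b) ≟ k)) ⌋

    K-intro : ∀ {b} → F b ≡ true → K (c (decode n b)) ≡ true
    K-intro {b} p = decided (any? (λ b′ → (F b′ ≟ᵇ true) ×-dec (c (decode n b′) ≟ c (decode n b)))) (b , p , refl)

    K-elim : ∀ {k} → K k ≡ true → ∃ λ b → F b ≡ true × c (decode n b) ≡ k
    K-elim {k} p = witness (any? (λ b → (F b ≟ᵇ true) ×-dec (c (decode n b) ≟ k))) p

    N = nbr R P
    N₁ : Fin E → Bool
    N₁ b = N (b Fin.↑ˡ Units)
    N₂ : Fin Units → Bool
    N₂ d = N (E Fin.↑ʳ d)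

    slots-bound : count slots ≤ count X * t
    slots-bound = count-inj slots (λ a p → combine (rank X (row a) (X-intro p)) (proj₂ (Fin.remQuot {n} t a))) inj
      where
      inj : ∀ {a b} p q → combine (rank X (row a) (X-intro p)) (proj₂ (Fin.remQuot {n} t a))
        ≡ combine (rank X (row b) (X-intro q)) (proj₂ (Fin.remQuot {n} t b)) → a ≡ b
      inj {a} {b} p q e =
        let e₁ , e₂ = Finₚ.combine-injective (rank X (row a) (X-intro p)) _ (rank X (row b) (X-intro q)) _ e in
        trans (sym (Finₚ.combine-remQuot {n} t a))
        (trans (cong₂ combine (rank-injective X _ _ e₁) e₂) (Finₚ.combine-remQuot {n} t b))

    F⊆N₁ : ∀ b → F b ≡ true → N₁ b ≡ true
    F⊆N₁ b p = nbr-intro {R = R} {P} p (R-join (inj₂ b) (inj₁ b) (decided (b ≟ b) refl))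

    touching⊆N₁ : ∀ b {v} → X v ≡ true → Incident v (decode n b) → N₁ b ≡ true
    touching⊆N₁ b p inc with X-elim p
    ... | a , q , refl = nbr-intro {R = R} {P} q (R-join (inj₁ a) (inj₁ b) (decided (incident? (row a) (decode n b)) inc))

    D⊆N₁ : ∀ b → D b ≡ true → N₁ b ≡ true
    D⊆N₁ b p with ∨-elim (X (lo (decode n b))) (proj₁ (∧-elim (touches (decode n b)) p))
    ... | inj₁ q = touching⊆N₁ b q (inj₁ refl)
    ... | inj₂ q = touching⊆N₁ b q (inj₂ refl)

    N₁-bound : count F + count D ≤ count N₁
    N₁-bound = begin
      count F + count D                                    ≡⟨ count-∨∧ F D ⟨
      count (λ b → F b ∨ D b) + count (λ b → F b ∧ D b)    ≤⟨ +-mono-≤ (count-mono union) disjoint ⟩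
      count N₁ + 0                                         ≡⟨ ℕₚ.+-identityʳ _ ⟩
      count N₁                                             ∎
      where
      open ≤-Reasoning
      union : ∀ b → F b ∨ D b ≡ true → N₁ b ≡ true
      union b p with ∨-elim (F b) p
      ... | inj₁ q = F⊆N₁ b q
      ... | inj₂ q = D⊆N₁ b q
      absurd : ∀ b → F b ∧ D b ≡ true → ⊥
      absurd b p with ∧-elim (F b) p
      ... | q , r = not-true (proj₂ (∧-elim (touches (decode n b)) r)) q
      disjoint : count (λ b → F b ∧ D b) ≤ 0
      disjoint = count-inj _ (λ b p → ⊥-elim (absurd b p)) (λ {b} p _ _ → ⊥-elim (absurd b p))

    N₂-bound : count K * t ≤ count N₂
    N₂-bound = product-injective⇒≤ (λ k j → rank N₂ (combine (elem k) j) (elem∈N₂ k j)) inj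
      where
      elem = proj₁ (elements K)
      elem∈N₂ : ∀ k j → N₂ (combine (elem k) j) ≡ true
      elem∈N₂ k j with K-elim (proj₁ (proj₂ (elements K)) k)
      ... | b , p , e = nbr-intro {R = R} {P} p (R-join (inj₂ b) (inj₂ _)
        (decided (c (decode n b) ≟ _) (trans e (sym (cong proj₁ (Finₚ.remQuot-combine {m} {t} (elem k) j))))))
      inj : ∀ {k j k′ j′} →
        rank N₂ (combine (elem k) j) (elem∈N₂ k j) ≡ rank N₂ (combine (elem k′) j′) (elem∈N₂ k′ j′) →
        k ≡ k′ × j ≡ j′
      inj {k} {j} {k′} {j′} e =
        let e₁ , e₂ = Finₚ.combine-injective (elem k) j (elem k′) j′
              (rank-injective N₂ (elem∈N₂ k j) (elem∈N₂ k′ j′) e)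
        in proj₂ (proj₂ (elements K)) e₁ , e₂

    open Inside Y

    D-intro : ∀ e → touches e ≡ true → F (code e) ≢ true → D (code e) ≡ true
    D-intro e p q = ∧-intro (trans (cong touches (decode-code e)) p) (not-intro q)

    outside-lo : ∀ e → touches e ≢ true → Y (lo e) ≡ true
    outside-lo e h = not-intro (h ∘ ∨-introˡ _)

    outside-hi : ∀ e → touches e ≢ true → Y (hi e) ≡ true
    outside-hi e h = not-intro (h ∘ ∨-introʳ (X (lo e)))

    -- An edge outside `F` either meets `X` and so belongs to `D`, or has both ends in the
    -- complement `Y`. Both counts below, of edges and of colours, rest on this.
    place : ∀ e → F (code e) ≢ true → Dec (touches e ≡ true) → Fin (count D) ⊎ Fin (tri (count Y))
    place e q (yes p) = inj₁ (rank D (code e) (D-intro e p q))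
    place e q (no h)  = inj₂ (inside-code e (outside-lo e h) (outside-hi e h))

    place-injective : ∀ e e′ q q′ d d′ → place e q d ≡ place e′ q′ d′ → e ≡ e′
    place-injective e e′ q q′ (yes _) (yes _) eq = code-injective (rank-injective D _ _ (inj₁-injective eq))
    place-injective e e′ q q′ (no h)  (no h′) eq = inside-code-injective e e′
      {outside-lo e h} {outside-hi e h} {outside-lo e′ h′} {outside-hi e′ h′} (inj₂-injective eq)

    edges-bound : (∀ b → F b ≢ true) → E ≤ count D + tri (count Y)
    edges-bound none = injective⇒≤ {f = λ b → join (count D) (tri (count Y)) (f b)}
      (λ {b} {b′} e → decode-injective n (place-injective (decode n b) (decode n b′) (none _) (none _) (dec b) (dec b′)
        (join-injective {count D} {tri (count Y)} e)))
      where
      dec : ∀ b → Dec (touches (decode n b) ≡ true)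
      dec b = touches (decode n b) ≟ᵇ true
      f : Fin E → Fin (count D) ⊎ Fin (tri (count Y))
      f b = place (decode n b) (none (code (decode n b))) (dec b)

    -- Each colour is represented by one edge. If the colour is not in `K`, this edge is outside `F`
    -- and can be placed.
    colours-bound : m ≤ count K + (count D + tri (count Y))
    colours-bound = injective⇒≤
      {f = λ k → join (count K) _ (f k (K k ≟ᵇ true))}
      (λ {k} {k′} e → f-inj k k′ (K k ≟ᵇ true) (K k′ ≟ᵇ true) (join-injective {count K} e))
      where
      rep : Fin m → Edge n
      rep k = proj₁ (c-surj k)
      rep-injective : ∀ {k k′} → rep k ≡ rep k′ → k ≡ k′
      rep-injective {k} {k′} e = trans (sym (proj₂ (c-surj k))) (trans (cong c e) (proj₂ (c-surj k′)))
      unused : ∀ k → K k ≢ true → F (code (rep k)) ≢ true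
      unused k h p = h (subst (λ z → K z ≡ true) (trans (cong c (decode-code (rep k))) (proj₂ (c-surj k))) (K-intro p))
      dec : ∀ k → Dec (touches (rep k) ≡ true)
      dec k = touches (rep k) ≟ᵇ true
      f : ∀ k → Dec (K k ≡ true) → Fin (count K) ⊎ Fin (count D + tri (count Y))
      f k (yes p) = inj₁ (rank K k p)
      f k (no h)  = inj₂ (join (count D) (tri (count Y)) (place (rep k) (unused k h) (dec k)))
      f-inj : ∀ k k′ d d′ → f k d ≡ f k′ d′ → k ≡ k′
      f-inj k k′ (yes p) (yes p′) e = rank-injective K _ _ (inj₁-injective e)
      f-inj k k′ (no h)  (no h′)  e = rep-injective (place-injective
        (rep k) (rep k′) (unused k h) (unused k′ h′) (dec k) (dec k′)
        (join-injective {count D} {tri (count Y)} (inj₂-injective e)))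

    -- The first hypothesis settles the case of empty `F`, the second the case of nonempty `F` when
    -- `X` has `2 + k` vertices; `j` is the size of `Y`.
    module _ (many-edges : ∀ j k → j + k ≡ n → t * k + tri j ≤ tri n)
             (many-colours : ∀ j k → j + (2 + k) ≡ n → tri j + t * suc k < m) where

      Y+X≡n : count Y + count X ≡ n
      Y+X≡n = count-not X

      demand-unused : (∀ b → F b ≢ true) → count X * t ≤ count D
      demand-unused none = ℕₚ.+-cancelʳ-≤ (tri (count Y)) _ _ (begin
        count X * t + tri (count Y)  ≡⟨ cong (_+ tri (count Y)) (ℕₚ.*-comm (count X) t) ⟩
        t * count X + tri (count Y)  ≤⟨ many-edges (count Y) (count X) Y+X≡n ⟩
        tri n                        ≤⟨ edges-bound none ⟩
        count D + tri (count Y)      ∎)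
        where open ≤-Reasoning

      -- One colour already supplies `t` units, enough for at most one vertex. For `k` ≥ 2 vertices
      -- the hypotheses give q + d ≥ t(k-1) + 1, and counting each of the `q` ≥ 1 colours `t` times
      -- instead of once adds the missing t-1.
      arithmetic : ∀ t k j q d → j + k ≡ n → 1 ≤ q → m ≤ q + (d + tri j) →
        (∀ j k → j + (2 + k) ≡ n → tri j + t * suc k < m) → k * t ≤ d + q * t
      arithmetic zero    k             j q d _ _   _ _ = ≤-trans (≤-reflexive (ℕₚ.*-zeroʳ k)) z≤n
      arithmetic (suc s) zero          j q d _ _   _ _ = z≤n
      arithmetic (suc s) (suc zero)    j (suc q) d _ _ _ _ =
        ≤-trans (≤-trans (≤-reflexive (ℕₚ.*-identityˡ (suc s))) (ℕₚ.m≤m+n (suc s) (q * suc s))) (ℕₚ.m≤n+m _ d)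
      arithmetic (suc s) (suc (suc k)) j (suc q) d jk _ bound many = ℕₚ.+-cancelʳ-≤ (tri j) _ _ (begin
        suc (suc k) * suc s + tri j              ≡⟨ e₁ s k (tri j) ⟩
        suc (tri j + suc s * suc k) + s          ≤⟨ ℕₚ.+-monoˡ-≤ s (≤-trans (many j k jk) bound) ⟩
        suc q + (d + tri j) + s                  ≤⟨ ℕₚ.m≤m+n _ (q * s) ⟩
        suc q + (d + tri j) + s + q * s          ≡⟨ e₂ s q d (tri j) ⟩
        d + suc q * suc s + tri j                ∎)
        where
        open ≤-Reasoning
        e₁ : ∀ s k x → suc (suc k) * suc s + x ≡ suc (x + suc s * suc k) + s
        e₁ = solve-∀
        e₂ : ∀ s q d x → suc q + (d + x) + s + q * s ≡ d + suc q * suc s + x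
        e₂ = solve-∀

      demand : count X * t ≤ count D + count K * t
      demand with any? (λ b → F b ≟ᵇ true)
      ... | no none = ≤-trans (demand-unused (λ b p → none (b , p))) (ℕₚ.m≤m+n _ _)
      ... | yes (b , p) = arithmetic t (count X) (count Y) (count K) (count D) Y+X≡n
        (≤-trans (s≤s z≤n) (Finₚ.toℕ<n (rank K _ (K-intro p)))) colours-bound many-colours

      not-deficient : count P ≤ count N
      not-deficient = begin
        count P                                 ≡⟨ count-⊎ {Slots} {E} P ⟩
        count slots + count F                   ≤⟨ ℕₚ.+-monoˡ-≤ (count F) (≤-trans slots-bound demand) ⟩
        count D + count K * t + count F         ≡⟨ rearrange (count D) (count K * t) (count F) ⟩
        count F + count D + count K * t         ≤⟨ +-mono-≤ N₁-bound N₂-bound ⟩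
        count N₁ + count N₂                     ≡⟨ count-⊎ {E} {Units} N ⟨
        count N                                 ∎
        where
        open ≤-Reasoning
        rearrange : ∀ x y z → x + y + z ≡ z + x + y
        rearrange = solve-∀

  module FromMatching (M : Fin Slots ⊎ Fin E → Fin E ⊎ Fin Units)
    (M-related : ∀ x → related x (M x) ≡ true) (M-inj : Injective _≡_ _≡_ M) where

    slot-edge : ∀ a → ∃ λ b → M (inj₁ a) ≡ inj₁ b × Incident (row a) (decode n b)
    slot-edge a with M (inj₁ a) | M-related (inj₁ a)
    ... | inj₁ b | r = b , refl , witness (incident? (row a) (decode n b)) r

    unit : ∀ a → ∃ λ d →
      M (inj₂ (proj₁ (slot-edge a))) ≡ inj₂ d × c (decode n (proj₁ (slot-edge a))) ≡ colour-of d
    unit a with slot-edge a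
    ... | b , used , _ = go (M (inj₂ b)) refl (M-related (inj₂ b))
      where
      go : ∀ y → M (inj₂ b) ≡ y → related (inj₂ b) y ≡ true →
        ∃ λ d → M (inj₂ b) ≡ inj₂ d × c (decode n b) ≡ colour-of d
      go (inj₂ d)  e r = d , e , witness (c (decode n b) ≟ colour-of d) r
      -- The slot already occupies `b` on the right, so the left copy of `b` cannot be matched to
      -- it.
      go (inj₁ b′) e r with refl ← witness (b ≟ b′) r = contradiction (M-inj (trans e (sym used))) λ ()

    φ : Fin n → Fin t → Edge n
    φ v s = decode n (proj₁ (slot-edge (combine v s)))

    φ-incident : ∀ v s → Incident v (φ v s)
    φ-incident v s = subst (λ u → Incident u (φ v s)) (cong proj₁ (Finₚ.remQuot-combine {n} {t} v s))
      (proj₂ (proj₂ (slot-edge (combine v s))))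

    slot-edge-injective : ∀ (v : Fin n) (s : Fin t) (v′ : Fin n) (s′ : Fin t) →
      proj₁ (slot-edge (combine v s)) ≡ proj₁ (slot-edge (combine v′ s′)) → v ≡ v′ × s ≡ s′
    slot-edge-injective v s v′ s′ e = Finₚ.combine-injective v s v′ s′ (inj₁-injective (M-inj
      (trans (proj₁ (proj₂ (slot-edge (combine v s))))
        (trans (cong inj₁ e) (sym (proj₁ (proj₂ (slot-edge (combine v′ s′)))))))))

    φ-injective : ∀ v s v′ s′ → φ v s ≡ φ v′ s′ → v ≡ v′ × s ≡ s′
    φ-injective v s v′ s′ e = slot-edge-injective v s v′ s′ (decode-injective n e)

    κ : Fin n → Fin t → Fin m
    κ v s = c (φ v s)

    ρ : Fin n → Fin t → Fin t
    ρ v s = proj₂ (Fin.remQuot {m} t (proj₁ (unit (combine v s))))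

    -- Equal colours and equal numbers mean the same unit. The matching assigns a unit to one edge
    -- only, and that edge to one slot only.
    κρ-injective : InjectivePair κ ρ
    κρ-injective {v} {s} {v′} {s′} eκ eρ = slot-edge-injective v s v′ s′ (inj₂-injective (M-inj
      (trans (proj₁ (proj₂ u)) (trans (cong inj₂ same-unit) (sym (proj₁ (proj₂ u′)))))))
      where
      u = unit (combine v s)
      u′ = unit (combine v′ s′)
      same-unit : proj₁ u ≡ proj₁ u′
      same-unit = trans (sym (Finₚ.combine-remQuot {m} t (proj₁ u)))
        (trans (cong₂ combine (trans (sym (proj₂ (proj₂ u))) (trans eκ (proj₂ (proj₂ u′)))) eρ)
          (Finₚ.combine-remQuot {m} t (proj₁ u′)))

    from-columns : RainbowColumns κ → RainbowOrientations c t
    from-columns (σ , σ-inj , σ-rainbow) =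
      (λ i v → φ v (σ i v)) ,
      (λ i → (λ v → φ-incident v (σ i v)) , λ {u} {v} e → proj₁ (φ-injective u (σ i u) v (σ i v) e)) ,
      (λ i → σ-rainbow i) ,
      separate
      where
      separate : ∀ {i j u v} → φ u (σ i u) ≡ φ v (σ j v) → i ≡ j
      separate {i} {j} {u} {v} e with φ-injective u (σ i u) v (σ j v) e
      ... | refl , e′ = σ-inj u e′

    orientations : RainbowOrientations c t
    orientations = from-columns (rainbow-columns κ ρ κρ-injective)

  from-hall : Matching R → RainbowOrientations c t
  from-hall (f , f∈ , f-inj) = FromMatching.orientations
    (λ x → Fin.splitAt E (f (join Slots E x)))
    (λ x → trans (cong (λ z → related z (Fin.splitAt E (f (join Slots E x))))
      (sym (Finₚ.splitAt-join Slots E x))) (f∈ (join Slots E x)))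
    (λ {x} {y} e → join-injective {Slots} {E} (f-inj (trans (sym (Finₚ.join-splitAt E Units _))
      (trans (cong (join E Units) e) (Finₚ.join-splitAt E Units _)))))

  rainbow-orientations : (∀ j k → j + k ≡ n → t * k + tri j ≤ tri n) →
    (∀ j k → j + (2 + k) ≡ n → tri j + t * suc k < m) → RainbowOrientations c t
  rainbow-orientations many-edges many-colours =
    from-hall (hall R λ P → Deficiency.not-deficient P many-edges many-colours)

orientations⇒family : ∀ {n m} {c : Edge n → Fin m} {t} →
  RainbowOrientations c t → HasDisjointRainbowUnicyclic c t
orientations⇒family {n} {c = c} {t} (g , orient , rainbow , separate) =
  F , (λ i → FunctionalGraph.unicyclic (g i) (orient i) (F i) (F-intro i) (F-elim i)) , F-rainbow , disjoint
  where
  F : Fin t → Subgraph n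
  -- Edges are compared through their codes, for which equality is decidable.
  F i e = ⌊ any? (λ v → code (g i v) ≟ code e) ⌋
  F-intro : ∀ i v → g i v ∈ₛ F i
  F-intro i v = decided (any? (λ u → code (g i u) ≟ code (g i v))) (v , refl)
  F-elim : ∀ i e → e ∈ₛ F i → ∃ λ v → g i v ≡ e
  F-elim i e h = let v , p = witness (any? (λ v → code (g i v) ≟ code e)) h in v , code-injective p
  F-rainbow : ∀ i e e′ → e ∈ₛ F i → e′ ∈ₛ F i → c e ≡ c e′ → e ≡ e′
  F-rainbow i e e′ h h′ eq with F-elim i e h | F-elim i e′ h′
  ... | u , refl | v , refl = cong (g i) (rainbow i eq)
  disjoint : ∀ i j → i ≢ j → ∀ e → e ∈ₛ F i → e ∈ₛ F j → ⊥
  disjoint i j i≢j e h h′ with F-elim i e h | F-elim j e h′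
  ... | u , p | v , q = i≢j (separate (trans p (sym q)))

-- Admissible colourings and the three ranges of `n`

capped-admissible : ∀ {n t M} (M< : M < tri n) → ¬ RainbowOrientations (Capped.colour n M M<) t →
  Admissible n t (suc M)
capped-admissible {n} {t} {M} M< none = colour , colour-surjective , none ∘ family⇒orientations
  where open Capped n M M<

colours≤edges : ∀ {n t m} → Admissible n t m → m ≤ tri n
colours≤edges (c , c-surj , _) = injective⇒≤ {f = λ k → code (proj₁ (c-surj k))} λ {k} {l} e →
  trans (sym (proj₂ (c-surj k))) (trans (cong c (code-injective e)) (proj₂ (c-surj l)))

-- The expression bounded by `B` is the number of colours compatible with a deficient set of `2 + k`
-- vertices, so more than `B` colours leave no such set.
colours-bounded : ∀ {n t m} B → 2 * t + 1 ≤ n →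
  (∀ j k → j + (2 + k) ≡ n → tri j + t * suc k ≤ B) → Admissible n t m → m ≤ B
colours-bounded {n} {t} {m} B big extremal (c , c-surj , none) with m ℕ.≤? B
... | yes m≤B = m≤B
... | no  m≰B = contradiction
  (orientations⇒family (Assignment.rainbow-orientations c c-surj t
    (λ { j k refl → tri-slope {t} j k big })
    (λ j k e → ≤-trans (s≤s (extremal j k e)) (ℕₚ.≰⇒> m≰B))))
  none

-- Even the colouring with all colours distinct, which is the capped one for `M = tri n ∸ 1`, is
-- admissible: the subgraphs would need `t * n` edges, more than n(n-1)/2.
arbc-small : ∀ {n t} → 3 ≤ n → n ≤ 2 * t → IsArbc n t (tri n)
arbc-small {n} {t} 3≤n n≤2t =
  subst (Admissible n t) suc-M (capped-admissible M< (too-few {c = Capped.colour n M M<})) ,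
  λ m → colours≤edges
  where
  M = tri n ∸ 1
  suc-M : suc M ≡ tri n
  suc-M = ℕₚ.m+[n∸m]≡n (≤-trans (s≤s z≤n) (tri-mono 3≤n))
  M< : M < tri n
  M< = ≤-reflexive suc-M
  too-few : ∀ {m} {c : Edge n → Fin m} → ¬ RainbowOrientations c t
  too-few {c = c} o = contradiction (≤-trans 3≤n (ℕₚ.+-cancelˡ-≤ (n * n) _ _ (begin
    n * n + n            ≤⟨ ℕₚ.+-monoˡ-≤ n (ℕₚ.*-monoˡ-≤ n n≤2t) ⟩
    2 * t * n + n        ≡⟨ cong (_+ n) (double t n) ⟩
    t * n + t * n + n    ≤⟨ ℕₚ.+-monoˡ-≤ n (+-mono-≤ (orientations-bound {c = c} o) (orientations-bound {c = c} o)) ⟩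
    tri n + tri n + n    ≡⟨ tri-double n ⟩
    n * n                ≡⟨ ℕₚ.+-identityʳ (n * n) ⟨
    n * n + 0            ∎))) λ ()
    where
    open ≤-Reasoning
    double : ∀ t n → 2 * t * n ≡ t * n + t * n
    double = solve-∀

arbc-middle : ∀ {n t} → 1 ≤ t → 2 * t + 1 ≤ suc (suc n) → suc (suc n) ≤ 2 * t + 3 →
  IsArbc (suc (suc n)) t (t * suc n)
arbc-middle {n} {suc s} _ big notbig =
  capped-admissible {t = suc s} {M} M< (λ o → contradiction (capped-bound M< o) (ℕₚ.<⇒≱ (≤-reflexive count-slots))) ,
  λ m → colours-bounded (suc s * suc n) big extremal
  where
  -- One less than the claimed number of colours. Then `M + t` falls short of the `t * (n + 2)`
  -- owned edges by exactly one.
  M = n + s * suc n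
  M< : M < tri (2 + n)
  M< = ≤-trans (ℕₚ.m≤m+n (suc s * suc n) 0) (tri-slope {suc s} 1 (suc n) big)
  count-slots : suc (M + suc s) ≡ suc s * suc (suc n)
  count-slots = e s n
    where
    e : ∀ s n → suc (n + s * suc n + suc s) ≡ suc s * suc (suc n)
    e = solve-∀
  -- Here `j` ≤ `n` ≤ 2t + 1, so `tri j` is at most tj and the bound becomes linear in `j + k`.
  extremal : ∀ j k → j + (2 + k) ≡ suc (suc n) → tri j + suc s * suc k ≤ suc s * suc n
  extremal j k e = begin
    tri j + suc s * suc k         ≤⟨ ℕₚ.+-monoˡ-≤ _ (tri-≤-linear {suc s} j j-small) ⟩
    suc s * j + suc s * suc k     ≡⟨ ℕₚ.*-distribˡ-+ (suc s) j (suc k) ⟨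
    suc s * (j + suc k)           ≡⟨ cong (suc s *_) (ℕₚ.suc-injective (trans (sym (+-suc j (suc k))) e)) ⟩
    suc s * suc n                 ∎
    where
    open ≤-Reasoning
    j-small : j ≤ 2 * suc s + 1
    j-small = ℕₚ.+-cancelʳ-≤ 2 _ _ (begin
      j + 2              ≤⟨ ℕₚ.+-monoʳ-≤ j (ℕₚ.m≤m+n 2 k) ⟩
      j + (2 + k)        ≡⟨ e ⟩
      suc (suc n)        ≤⟨ notbig ⟩
      2 * suc s + 3      ≡⟨ +-assoc (2 * suc s) 1 2 ⟨
      2 * suc s + 1 + 2  ∎)

arbc-large : ∀ {n t} → 1 ≤ t → 2 * t + 2 ≤ n → IsArbc (2 + n) t (tri n + t)
arbc-large {n} {suc s} _ big =
  subst (Admissible (2 + n) (suc s)) (sym (+-suc (tri n) s)) (capped-admissible M< (no-two-vertex-cover M<)) ,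
  λ m → colours-bounded (tri n + suc s) (≤-trans n-big (ℕₚ.m≤n+m n 2)) extremal
  where
  open ≤-Reasoning
  n-big : 2 * suc s + 1 ≤ n
  n-big = ≤-trans (ℕₚ.+-monoʳ-≤ (2 * suc s) (s≤s z≤n)) big
  s≤n : s ≤ n
  s≤n = ≤-trans (≤-trans (ℕₚ.n≤1+n s) (ℕₚ.m≤m+n (suc s) _)) (≤-trans (ℕₚ.m≤m+n (2 * suc s) 1) n-big)
  M< : tri n + s < tri (2 + n)
  M< = s≤s (begin
    tri n + s        ≡⟨ +-comm (tri n) s ⟩
    s + tri n        ≤⟨ ℕₚ.+-monoˡ-≤ (tri n) s≤n ⟩
    n + tri n        ≤⟨ ℕₚ.m≤n+m _ n ⟩
    n + (n + tri n)  ∎)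
  -- The case `k = 0` is extremal: by `tri-slope`, moving `k` vertices into the rainbow part gains
  -- at least tk edges there.
  extremal : ∀ j k → j + (2 + k) ≡ 2 + n → tri j + suc s * suc k ≤ tri n + suc s
  extremal j k e = begin
    tri j + suc s * suc k          ≡⟨ rearrange (tri j) (suc s) k ⟩
    (suc s * k + tri j) + suc s    ≤⟨ ℕₚ.+-monoˡ-≤ (suc s) (tri-slope {suc s} j k j+k-big) ⟩
    tri (j + k) + suc s            ≡⟨ cong (λ z → tri z + suc s) j+k≡n ⟩
    tri n + suc s                  ∎
    where
    rearrange : ∀ x t k → x + t * suc k ≡ (t * k + x) + t
    rearrange = solve-∀
    j+k≡n : j + k ≡ n
    j+k≡n = ℕₚ.+-cancelˡ-≡ 2 _ _ (trans (sym (trans (+-suc j (suc k)) (cong suc (+-suc j k)))) e)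
    j+k-big : 2 * suc s + 1 ≤ j + k
    j+k-big = subst (2 * suc s + 1 ≤_) (sym j+k≡n) n-big

theorem15 : (n t : ℕ) → 3 ≤ n → 1 ≤ t →
    (n ≤ 2 * t → IsArbc n t (n C 2)) ×
    (2 * t + 1 ≤ n → n ≤ 2 * t + 3 → IsArbc n t (t * (n ∸ 1))) ×
    (2 * t + 4 ≤ n → IsArbc n t ((n ∸ 2) C 2 + t))
theorem15 (suc (suc n)) t 3≤n 1≤t =
  (λ h → subst (IsArbc (2 + n) t) (tri≡C2 (2 + n)) (arbc-small 3≤n h)) ,
  arbc-middle 1≤t ,
  λ h → subst (λ z → IsArbc (2 + n) t (z + t)) (tri≡C2 n)
    (arbc-large 1≤t (ℕₚ.+-cancelʳ-≤ 2 _ _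
      (≤-trans (≤-reflexive (+-assoc (2 * t) 2 2)) (≤-trans h (≤-reflexive (+-comm 2 n))))))
theorem15 (suc zero) t (s≤s ())
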